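{- Let $\alpha$ and $n$ be non-negative integers. (i) Let $p$ be a prime with $p \equiv 1 \pmod 6$. If $p \nmid (3n+1)$ and $B_{3,7} \left(\frac{p-1}{3}\right)\equiv 0 \pmod 3$, then $B_{3,7}\left(p^{2 \alpha+1}n+ \frac{p^{2 \alpha +1}-1}{3}\right) \equiv 0 \pmod 3$. (ii) Let $p$ be a prime with $p \equiv 1 \pmod 4$. If $p \nmid (4n+1)$ and $B_{3,5} \left(\frac{p-1}{4}\right)\equiv 0 \pmod 3$, then $B_{3,5}\left(p^{2 \alpha+1}n+ \frac{p^{2 \alpha +1}-1}{4}\right) \equiv 0 \pmod 3$. (iii) Let $p$ be a prime with $p \equiv 1 \pmod 8$. If $p \nmid (8n+1)$ and $B_{3,2} \left(\frac{p-1}{8}\right)\equiv 0 \pmod 3$, then $B_{3,2}\left(p^{2 \alpha+1}n+ \frac{p^{2 \alpha +1}-1}{8}\right) \equiv 0 \pmod 3$.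
   Context: For integers $u,v\ge 2$, $B_{u,v}(n)$ is the number of bipartitions $(\alpha,\beta)$ of $n$ with $\alpha$ having no part divisible by $u$ and $\beta$ having no part divisible by $v$; $B_{u,v}(0)=1$ and $\sum_{n\ge0}B_{u,v}(n)q^n=\frac{f_uf_v}{f_1^2}$, $f_t=\prod_{k\ge1}(1-q^{tk})$. -}

module Defs where

open import Data.Nat using (ℕ; zero; suc; _+_; _*_; _∸_; _≤?_)
open import Data.Nat.Divisibility using (_∣?_)
open import Data.List using (List; map; upTo)
open import Data.Nat.ListAction using (sum)
open import Relation.Nullary using (yes; no)

-- partsLE u k m : number of partitions of m into parts of size ≤ k,
-- no part divisible by u.  Recursion on k: choose the multiplicity j of
-- the part k+1 (allowed only if u ∤ k+1), remaining m - j(k+1) uses parts ≤ k.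
partsLE : ℕ → ℕ → ℕ → ℕ
partsLE u zero zero = 1
partsLE u zero (suc m) = 0
partsLE u (suc k) m with u ∣? suc k
... | yes _ = partsLE u k m
... | no _ = sum (map term (upTo (suc m)))
  where
  term : ℕ → ℕ
  term j with j * suc k ≤? m
  ... | yes _ = partsLE u k (m ∸ j * suc k)
  ... | no _ = 0

pnd : ℕ → ℕ → ℕ
pnd u m = partsLE u m m

-- B u v n : number of bipartitions (α, β) of n, α with no part divisible
-- by u and β with no part divisible by v  (|α| = k, |β| = n - k).
B : ℕ → ℕ → ℕ → ℕ
B u v n = sum (map (λ k → pnd u k * pnd v (n ∸ k)) (upTo (suc n)))

{-# OPTIONS --safe #-}
module Submission where

-- Modulo 3 one has f₃ ≡ f₁³, so for D = 7, 5, 2 the series of B₃,D is congruent to f₁ f_D, and by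
-- Euler's pentagonal theorem B₃,D(n) ≡ Σ χ(x) χ(y) over x, y ≥ 0 with x² + D y² = 24 n + 1 + D,
-- where χ is the even character modulo 12.  Put 24 = (1 + D) d.  If -D is not a square modulo p,
-- then (1 + D) p^(2α+1) m with p ∤ (1 + D) m is not of the form x² + D y², and the sum for
-- n = p^(2α+1) n' + (p^(2α+1) - 1) / d is empty.  If -D is a square modulo p, then p = D or
-- p = a² + D b², in which case (1 + D) p = x² + D y² has exactly the two solutions (a + D b, |a - b|)
-- and (|a - D b|, a + b); they carry the same sign, so B₃,D((p - 1) / d) ≡ ±2 is not divisible by 3.

-- The hypothesis on B₃,D((p - 1) / d) enters only by contraposition: it forces -D to be a
-- non-square modulo p, after which the whole progression vanishes by descent. The ramified prime p
-- = D is settled by evaluating B: B₃,₇(2) = 5 and B₃,₅(1) = 2; for D = 2 the class of p modulo 8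
-- rules it out. When -D is a square, Thue's lemma yields only k p = a² + D b² with 1 ≤ k ≤ D.
-- Passing to k = 1 is where the congruence on p matters: for D = 5 there is a second class of forms
-- of the same discriminant, and p ≡ 1 (mod 4) keeps p out of it. The two solutions for (1 + D) p
-- are the products (1 ± √-D)(a + b √-D). There are no others because t² + D s² = 1 + D has only t =
-- ±1, s = ±1 when 1 + D (here 3, 6 or 8) is not a square. No infinite product occurs. Series are
-- compared modulo q^(N+1), so q is nilpotent, products and theta sums are finite, and the
-- pentagonal theorem becomes Shanks' finite identity.

-- Power series over the field with three elements.

module SeriesMod3 where

  open import Algebra.Bundles using (CommutativeRing; RawRing)
  open import Algebra.Solver.Ring.AlmostCommutativeRing using (_-Raw-AlmostCommutative⟶_; fromCommutativeRing)
  open import Data.Fin using (Fin; zero; suc)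
  open import Data.Fin.Patterns
  open import Data.Fin.Properties using (all?) renaming (_≟_ to _≟ᶠ_)
  open import Data.Nat using (ℕ; zero; suc; _+_; _*_; _≤_; z≤n; s≤s)
  open import Data.Nat.Properties using (≤-trans; n≤1+n; ≤-refl)
  open import Data.Nat.Divisibility using (_∣_; divides; _∣0; ∣m∣n⇒∣m+n; ∣-refl)
  open import Data.Product using (_,_)
  open import Function using (_∘_)
  open import Level using (0ℓ)
  open import Relation.Binary.PropositionalEquality
  open import Relation.Nullary.Decidable using (from-yes)

  F₃ : Set
  F₃ = Fin 3

  infixl 6 _⊕_
  infixl 7 _⊗_
  infix 8 ⊖_

  _⊕_ : F₃ → F₃ → F₃
  0F ⊕ y = y
  1F ⊕ 0F = 1F
  1F ⊕ 1F = 2F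
  1F ⊕ 2F = 0F
  2F ⊕ 0F = 2F
  2F ⊕ 1F = 0F
  2F ⊕ 2F = 1F

  ⊖_ : F₃ → F₃
  ⊖ 0F = 0F
  ⊖ 1F = 2F
  ⊖ 2F = 1F

  _⊗_ : F₃ → F₃ → F₃
  0F ⊗ y = 0F
  1F ⊗ y = y
  2F ⊗ y = ⊖ y

  ⊕-assoc : ∀ x y z → (x ⊕ y) ⊕ z ≡ x ⊕ (y ⊕ z)
  ⊕-assoc = from-yes (all? λ x → all? λ y → all? λ z → (x ⊕ y) ⊕ z ≟ᶠ x ⊕ (y ⊕ z))

  ⊕-comm : ∀ x y → x ⊕ y ≡ y ⊕ x
  ⊕-comm = from-yes (all? λ x → all? λ y → x ⊕ y ≟ᶠ y ⊕ x)

  ⊗-assoc : ∀ x y z → (x ⊗ y) ⊗ z ≡ x ⊗ (y ⊗ z)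
  ⊗-assoc = from-yes (all? λ x → all? λ y → all? λ z → (x ⊗ y) ⊗ z ≟ᶠ x ⊗ (y ⊗ z))

  ⊗-comm : ∀ x y → x ⊗ y ≡ y ⊗ x
  ⊗-comm = from-yes (all? λ x → all? λ y → x ⊗ y ≟ᶠ y ⊗ x)

  ⊗-distribˡ : ∀ x y z → x ⊗ (y ⊕ z) ≡ x ⊗ y ⊕ x ⊗ z
  ⊗-distribˡ = from-yes (all? λ x → all? λ y → all? λ z → x ⊗ (y ⊕ z) ≟ᶠ x ⊗ y ⊕ x ⊗ z)

  ⊗-distribʳ : ∀ x y z → (y ⊕ z) ⊗ x ≡ y ⊗ x ⊕ z ⊗ x
  ⊗-distribʳ = from-yes (all? λ x → all? λ y → all? λ z → (y ⊕ z) ⊗ x ≟ᶠ y ⊗ x ⊕ z ⊗ x)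

  ⊕-identityʳ : ∀ x → x ⊕ 0F ≡ x
  ⊕-identityʳ = from-yes (all? λ x → x ⊕ 0F ≟ᶠ x)

  ⊗-identityʳ : ∀ x → x ⊗ 1F ≡ x
  ⊗-identityʳ = from-yes (all? λ x → x ⊗ 1F ≟ᶠ x)

  ⊗-zeroʳ : ∀ x → x ⊗ 0F ≡ 0F
  ⊗-zeroʳ = from-yes (all? λ x → x ⊗ 0F ≟ᶠ 0F)

  ⊖-inverseˡ : ∀ x → ⊖ x ⊕ x ≡ 0F
  ⊖-inverseˡ = from-yes (all? λ x → ⊖ x ⊕ x ≟ᶠ 0F)

  ⊖-inverseʳ : ∀ x → x ⊕ ⊖ x ≡ 0F
  ⊖-inverseʳ = from-yes (all? λ x → x ⊕ ⊖ x ≟ᶠ 0F)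

  ⊖-distribˡ-⊗ : ∀ x y → ⊖ (x ⊗ y) ≡ ⊖ x ⊗ y
  ⊖-distribˡ-⊗ = from-yes (all? λ x → all? λ y → ⊖ (x ⊗ y) ≟ᶠ ⊖ x ⊗ y)

  F₃-ring : CommutativeRing 0ℓ 0ℓ
  F₃-ring = record
    { Carrier = F₃ ; _≈_ = _≡_ ; _+_ = _⊕_ ; _*_ = _⊗_ ; -_ = ⊖_ ; 0# = 0F ; 1# = 1F
    ; isCommutativeRing = record
      { isRing = record
        { +-isAbelianGroup = record
          { isGroup = record
            { isMonoid = record
              { isSemigroup = record
                { isMagma = record { isEquivalence = isEquivalence ; ∙-cong = cong₂ _⊕_ }
                ; assoc = ⊕-assoc }
              ; identity = (λ _ → refl) , ⊕-identityʳ }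
            ; inverse = ⊖-inverseˡ , ⊖-inverseʳ
            ; ⁻¹-cong = cong ⊖_ }
          ; comm = ⊕-comm }
        ; *-cong = cong₂ _⊗_
        ; *-assoc = ⊗-assoc
        ; *-identity = (λ _ → refl) , ⊗-identityʳ
        ; distrib = ⊗-distribˡ , ⊗-distribʳ }
      ; *-comm = ⊗-comm } }

  F₃-raw : RawRing 0ℓ 0ℓ
  F₃-raw = CommutativeRing.rawRing F₃-ring

  mod₃ : ℕ → F₃
  mod₃ zero = 0F
  mod₃ (suc n) = 1F ⊕ mod₃ n

  mod₃-+ : ∀ m n → mod₃ (m + n) ≡ mod₃ m ⊕ mod₃ n
  mod₃-+ zero n = refl
  mod₃-+ (suc m) n = trans (cong (1F ⊕_) (mod₃-+ m n)) (sym (⊕-assoc 1F (mod₃ m) (mod₃ n)))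

  mod₃-* : ∀ m n → mod₃ (m * n) ≡ mod₃ m ⊗ mod₃ n
  mod₃-* zero n = refl
  mod₃-* (suc m) n = trans (mod₃-+ n (m * n))
    (trans (cong (mod₃ n ⊕_) (mod₃-* m n)) (sym (⊗-distribʳ (mod₃ n) 1F (mod₃ m))))

  mod₃-3+ : ∀ n → mod₃ (3 + n) ≡ mod₃ n
  mod₃-3+ n = trans (cong (1F ⊕_) (sym (⊕-assoc 1F 1F (mod₃ n)))) (sym (⊕-assoc 1F 2F (mod₃ n)))

  mod₃≡0⇒3∣ : ∀ n → mod₃ n ≡ 0F → 3 ∣ n
  mod₃≡0⇒3∣ 0 _ = 3 ∣0
  mod₃≡0⇒3∣ (suc (suc (suc n))) e = ∣m∣n⇒∣m+n ∣-refl (mod₃≡0⇒3∣ n (trans (sym (mod₃-3+ n)) e))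

  3∣⇒mod₃≡0 : ∀ {n} → 3 ∣ n → mod₃ n ≡ 0F
  3∣⇒mod₃≡0 (divides q refl) = trans (mod₃-* q 3) (⊗-zeroʳ (mod₃ q))

  open import Algebra.Solver.Ring.Simple (fromCommutativeRing F₃-ring) _≟ᶠ_ public
    using () renaming (solve to solveF ; _:+_ to _:+ᶠ_ ; _:*_ to _:*ᶠ_ ; _:=_ to _:=ᶠ_)

  Series : Set
  Series = ℕ → F₃

  const : F₃ → Series
  const c zero = c
  const c (suc n) = 0F

  q : Series
  q zero = 0F
  q (suc zero) = 1F
  q (suc (suc n)) = 0F

  infixl 7 _⋆_
  _⋆_ : Series → Series → Series
  (f ⋆ g) zero = f 0 ⊗ g 0
  (f ⋆ g) (suc n) = f 0 ⊗ g (suc n) ⊕ ((f ∘ suc) ⋆ g) n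

  ⋆-cong : ∀ {f f′ g g′} n → (∀ k → k ≤ n → f k ≡ f′ k) → (∀ k → k ≤ n → g k ≡ g′ k) →
           (f ⋆ g) n ≡ (f′ ⋆ g′) n
  ⋆-cong zero ef eg = cong₂ _⊗_ (ef 0 z≤n) (eg 0 z≤n)
  ⋆-cong (suc n) ef eg = cong₂ _⊕_ (cong₂ _⊗_ (ef 0 z≤n) (eg (suc n) ≤-refl))
    (⋆-cong n (λ k le → ef (suc k) (s≤s le)) (λ k le → eg k (≤-trans le (n≤1+n n))))

  ⋆-distribʳ : ∀ h f g n → ((λ k → f k ⊕ g k) ⋆ h) n ≡ (f ⋆ h) n ⊕ (g ⋆ h) n
  ⋆-distribʳ h f g zero = ⊗-distribʳ (h 0) (f 0) (g 0)
  ⋆-distribʳ h f g (suc n) = trans (cong ((f 0 ⊕ g 0) ⊗ h (suc n) ⊕_) (⋆-distribʳ h (f ∘ suc) (g ∘ suc) n))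
    (solveF 5 (λ a b c x y → ((a :+ᶠ b) :*ᶠ c :+ᶠ (x :+ᶠ y)) :=ᶠ ((a :*ᶠ c :+ᶠ x) :+ᶠ (b :*ᶠ c :+ᶠ y)))
      refl (f 0) (g 0) (h (suc n)) (((f ∘ suc) ⋆ h) n) (((g ∘ suc) ⋆ h) n))

  ⋆-scaleˡ : ∀ c f g n → ((λ k → c ⊗ f k) ⋆ g) n ≡ c ⊗ (f ⋆ g) n
  ⋆-scaleˡ c f g zero = ⊗-assoc c (f 0) (g 0)
  ⋆-scaleˡ c f g (suc n) = trans (cong (c ⊗ f 0 ⊗ g (suc n) ⊕_) (⋆-scaleˡ c (f ∘ suc) g n))
    (trans (cong (_⊕ c ⊗ ((f ∘ suc) ⋆ g) n) (⊗-assoc c (f 0) (g (suc n)))) (sym (⊗-distribˡ c _ _)))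

  ⋆-assoc : ∀ f g h n → ((f ⋆ g) ⋆ h) n ≡ (f ⋆ (g ⋆ h)) n
  ⋆-assoc f g h zero = ⊗-assoc (f 0) (g 0) (h 0)
  ⋆-assoc f g h (suc n) = trans (cong (f 0 ⊗ g 0 ⊗ h (suc n) ⊕_)
      (trans (⋆-distribʳ h (λ k → f 0 ⊗ g (suc k)) ((f ∘ suc) ⋆ g) n)
        (cong₂ _⊕_ (⋆-scaleˡ (f 0) (g ∘ suc) h n) (⋆-assoc (f ∘ suc) g h n))))
    (solveF 5 (λ a b c x y → (a :*ᶠ b :*ᶠ c :+ᶠ (a :*ᶠ x :+ᶠ y)) :=ᶠ (a :*ᶠ (b :*ᶠ c :+ᶠ x) :+ᶠ y))
      refl (f 0) (g 0) (h (suc n)) (((g ∘ suc) ⋆ h) n) (((f ∘ suc) ⋆ (g ⋆ h)) n))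

  -- The recursion of `⋆` peels off the first coefficient of the left factor; commutativity needs
  -- the same step taken at the other end.
  ⋆-sucʳ : ∀ f g n → (f ⋆ g) (suc n) ≡ (f ⋆ (g ∘ suc)) n ⊕ f (suc n) ⊗ g 0
  ⋆-sucʳ f g zero = refl
  ⋆-sucʳ f g (suc n) = trans (cong (f 0 ⊗ g (suc (suc n)) ⊕_) (⋆-sucʳ (f ∘ suc) g n))
      (sym (⊕-assoc (f 0 ⊗ g (suc (suc n))) _ _))

  ⋆-comm : ∀ f g n → (f ⋆ g) n ≡ (g ⋆ f) n
  ⋆-comm f g zero = ⊗-comm (f 0) (g 0)
  ⋆-comm f g (suc n) = trans (cong₂ _⊕_ (⊗-comm (f 0) (g (suc n))) (⋆-comm (f ∘ suc) g n))
    (trans (⊕-comm (g (suc n) ⊗ f 0) _) (sym (⋆-sucʳ g f n)))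

  zero-⋆ : ∀ f n → ((λ _ → 0F) ⋆ f) n ≡ 0F
  zero-⋆ f zero = refl
  zero-⋆ f (suc n) = zero-⋆ f n

  const-⋆ : ∀ c f n → (const c ⋆ f) n ≡ c ⊗ f n
  const-⋆ c f zero = refl
  const-⋆ c f (suc n) = trans (cong (c ⊗ f (suc n) ⊕_) (zero-⋆ f n)) (⊕-identityʳ _)

  q-⋆-suc : ∀ f n → (q ⋆ f) (suc n) ≡ f n
  q-⋆-suc f n = trans (⋆-cong {g = f} n (λ { zero _ → refl ; (suc k) _ → refl }) (λ _ _ → refl)) (const-⋆ 1F f n)

  -- Power series modulo q^(N+1).
  module Truncated (N : ℕ) where

    infix 4 _≈_
    _≈_ : Series → Series → Set
    f ≈ g = ∀ n → n ≤ N → f n ≡ g n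

    ring : CommutativeRing 0ℓ 0ℓ
    ring = record
      { Carrier = Series ; _≈_ = _≈_ ; _+_ = λ f g n → f n ⊕ g n ; _*_ = _⋆_ ; -_ = λ f n → ⊖ f n
      ; 0# = λ _ → 0F ; 1# = const 1F
      ; isCommutativeRing = record
        { isRing = record
          { +-isAbelianGroup = record
            { isGroup = record
              { isMonoid = record
                { isSemigroup = record
                  { isMagma = record
                    { isEquivalence = record
                      { refl = λ _ _ → refl
                      ; sym = λ e n le → sym (e n le)
                      ; trans = λ d e n le → trans (d n le) (e n le) }
                    ; ∙-cong = λ d e n le → cong₂ _⊕_ (d n le) (e n le) }
                  ; assoc = λ f g h n _ → ⊕-assoc (f n) (g n) (h n) }
                ; identity = (λ _ _ _ → refl) , (λ f n _ → ⊕-identityʳ (f n)) }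
              ; inverse = (λ f n _ → ⊖-inverseˡ (f n)) , (λ f n _ → ⊖-inverseʳ (f n))
              ; ⁻¹-cong = λ e n le → cong ⊖_ (e n le) }
            ; comm = λ f g n _ → ⊕-comm (f n) (g n) }
          ; *-cong = λ d e n le → ⋆-cong n (λ k le′ → d k (≤-trans le′ le)) (λ k le′ → e k (≤-trans le′ le))
          ; *-assoc = λ f g h n _ → ⋆-assoc f g h n
          ; *-identity = (λ f n _ → const-⋆ 1F f n)
                       , (λ f n _ → trans (⋆-comm f (const 1F) n) (const-⋆ 1F f n))
          ; distrib = (λ h f g n _ → trans (⋆-comm h _ n) (trans (⋆-distribʳ h f g n)
                        (cong₂ _⊕_ (⋆-comm f h n) (⋆-comm g h n))))
                    , (λ h f g n _ → ⋆-distribʳ h f g n) }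
        ; *-comm = λ f g n _ → ⋆-comm f g n } }

    -- Along this map the ring solver takes its coefficients from F₃, so identities special to
    -- characteristic 3, such as (1 - y)³ = 1 - y³, are settled by normalisation.
    constants : F₃-raw -Raw-AlmostCommutative⟶ fromCommutativeRing ring
    constants = record
      { ⟦_⟧ = const
      ; +-homo = λ { x y zero _ → refl ; x y (suc n) _ → refl }
      ; *-homo = λ { x y zero _ → refl ; x y (suc n) _ → sym (trans (const-⋆ x (const y) (suc n)) (⊗-zeroʳ x)) }
      ; -‿homo = λ { x zero _ → refl ; x (suc n) _ → refl }
      ; 0-homo = λ { zero _ → refl ; (suc n) _ → refl }
      ; 1-homo = λ { zero _ → refl ; (suc n) _ → refl } }

-- Euler's pentagonal theorem in F₃-algebras, through Shanks' finite identity.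

module Pentagonal where

  open import Algebra.Bundles using (CommutativeRing)
  open import Algebra.Solver.Ring.AlmostCommutativeRing using (_-Raw-AlmostCommutative⟶_; fromCommutativeRing)
  import Algebra.Solver.Ring as RingSolver
  import Algebra.Properties.Semiring.Exp as Exp
  import Algebra.Properties.Ring as RingProperties
  open import Data.Fin.Patterns
  open import Data.Fin.Properties using () renaming (_≟_ to _≟ᶠ_)
  open import Data.Maybe using () renaming (map to mapMaybe)
  open import Data.Nat as ℕ using (ℕ; zero; suc)
  open import Data.Nat.DivMod using (m*n/n≡m)
  import Data.Nat.Properties as ℕ
  open import Data.Nat.Solver using (module +-*-Solver)
  open import Level using (0ℓ)
  open import Relation.Binary.PropositionalEquality as ≡ using (_≡_; cong; subst)
  open import Relation.Nullary.Decidable using (dec⇒maybe)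
  open SeriesMod3

  tri : ℕ → ℕ
  tri zero = 0
  tri (suc n) = suc n ℕ.+ tri n

  sgn : ℕ → F₃
  sgn zero = 1F
  sgn (suc n) = ⊖ sgn n

  -- At x = |6k - 1| this is the sign (-1)^k that Euler's theorem attaches to the exponent (x² - 1)
  -- / 24 = k(3k - 1) / 2.
  χ : ℕ → F₃
  χ 0 = 0F
  χ 1 = 1F
  χ 2 = 0F
  χ 3 = 0F
  χ 4 = 0F
  χ 5 = 2F
  χ (suc (suc (suc (suc (suc (suc n)))))) = ⊖ χ n

  -- The generalised pentagonal numbers, indexed by the x ≡ ±1 (mod 6); junk where χ vanishes.
  pentagonal : ℕ → ℕ
  pentagonal x = (x ℕ.* x ℕ.∸ 1) ℕ./ 24

  χ-r+6n : ∀ r n → χ (r ℕ.+ n ℕ.* 6) ≡ sgn n ⊗ χ r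
  χ-r+6n r = λ n → ≡.trans (cong χ (ℕ.+-comm r (n ℕ.* 6))) (go n)
    where
    go : ∀ n → χ (n ℕ.* 6 ℕ.+ r) ≡ sgn n ⊗ χ r
    go zero = ≡.refl
    go (suc n) = ≡.trans (cong ⊖_ (go n)) (⊖-distribˡ-⊗ (sgn n) (χ r))

  tri-double : ∀ n → 2 ℕ.* tri n ≡ n ℕ.* suc n
  tri-double zero = ≡.refl
  tri-double (suc n) = ≡.trans (ℕ.*-distribˡ-+ 2 (suc n) (tri n)) (≡.trans (cong (2 ℕ.* suc n ℕ.+_) (tri-double n))
    (solve 1 (λ n → con 2 :* (con 1 :+ n) :+ n :* (con 1 :+ n) := (con 1 :+ n) :* (con 2 :+ n)) ≡.refl n))
    where open +-*-Solver

  pentagonal-from : ∀ x e → x ℕ.* x ≡ suc (e ℕ.* 24) → pentagonal x ≡ e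
  pentagonal-from x e eq = ≡.trans (cong (λ y → (y ℕ.∸ 1) ℕ./ 24) eq) (m*n/n≡m e 24)

  square-1+6n : ∀ n → (1 ℕ.+ n ℕ.* 6) ℕ.* (1 ℕ.+ n ℕ.* 6) ≡ suc ((n ℕ.* n ℕ.+ tri n) ℕ.* 24)
  square-1+6n n = ≡.trans
    (solve 1 (λ n → (con 1 :+ n :* con 6) :* (con 1 :+ n :* con 6) := con 1 :+
        (n :* n :* con 24 :+ (n :* (con 1 :+ n)) :* con 12)) ≡.refl n)
    (≡.trans (cong (λ t → suc (n ℕ.* n ℕ.* 24 ℕ.+ t ℕ.* 12)) (≡.sym (tri-double n)))
    (solve 2 (λ n t → con 1 :+ (n :* n :* con 24 :+ con 2 :* t :* con 12) := con 1 :+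
        ((n :* n :+ t) :* con 24)) ≡.refl n (tri n)))
    where open +-*-Solver

  square-5+6n : ∀ n → (5 ℕ.+ n ℕ.* 6) ℕ.* (5 ℕ.+ n ℕ.* 6) ≡ suc ((suc n ℕ.* suc n ℕ.+ tri n) ℕ.* 24)
  square-5+6n n = ≡.trans
    (solve 1 (λ n → (con 5 :+ n :* con 6) :* (con 5 :+ n :* con 6) := con 1 :+
        ((con 1 :+ n) :* (con 1 :+ n) :* con 24 :+ (n :* (con 1 :+ n)) :* con 12)) ≡.refl n)
    (≡.trans (cong (λ t → suc (suc n ℕ.* suc n ℕ.* 24 ℕ.+ t ℕ.* 12)) (≡.sym (tri-double n)))
    (solve 2 (λ n t → con 1 :+ ((con 1 :+ n) :* (con 1 :+ n) :* con 24 :+ con 2 :* t :* con 12) := con 1 :+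
        (((con 1 :+ n) :* (con 1 :+ n) :+ t) :* con 24)) ≡.refl n (tri n)))
    where open +-*-Solver

  module Algebra₃ (A : CommutativeRing 0ℓ 0ℓ) (φ : F₃-raw -Raw-AlmostCommutative⟶ fromCommutativeRing A) where
    open CommutativeRing A hiding (zero)
    open Exp semiring
    open RingProperties ring using (-0#≈0#)
    open _-Raw-AlmostCommutative⟶_ φ
    open import Relation.Binary.Reasoning.Setoid setoid
    open RingSolver F₃-raw (fromCommutativeRing A) φ
      (λ a b → mapMaybe (λ e → reflexive (cong ⟦_⟧ e)) (dec⇒maybe (a ≟ᶠ b)))
      using (solve; _:=_; _:+_; _:*_; _:-_; :-_; _:^_; Polynomial) public

    -- con 1F denotes ⟦ 1F ⟧, whereas a zeroth power denotes 1# itself.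
    one : ∀ {n} → Polynomial n → Polynomial n
    one v = v :^ 0

    Σ< : ℕ → (ℕ → Carrier) → Carrier
    Σ< zero f = 0#
    Σ< (suc n) f = Σ< n f + f n

    Σ<-cong : ∀ n {f g} → (∀ k → f k ≈ g k) → Σ< n f ≈ Σ< n g
    Σ<-cong zero e = refl
    Σ<-cong (suc n) e = +-cong (Σ<-cong n e) (e n)

    Σ<-*ˡ : ∀ n c f → c * Σ< n f ≈ Σ< n (λ k → c * f k)
    Σ<-*ˡ zero c f = zeroʳ c
    Σ<-*ˡ (suc n) c f = trans (distribˡ c _ _) (+-congʳ (Σ<-*ˡ n c f))

    Σ<-*ʳ : ∀ n c f → Σ< n f * c ≈ Σ< n (λ k → f k * c)
    Σ<-*ʳ zero c f = zeroˡ c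
    Σ<-*ʳ (suc n) c f = trans (distribʳ c _ _) (+-congʳ (Σ<-*ʳ n c f))

    -- The element `x` is kept arbitrary because the results are applied to q, to q³ and to q^D.
    module Powers (x : Carrier) where

      prod : ℕ → ℕ → Carrier
      prod s zero = 1#
      prod s (suc m) = prod s m * (1# - x ^ suc (s ℕ.+ m))

      prod-sucˡ : ∀ s m → prod s (suc m) ≈ (1# - x ^ suc s) * prod (suc s) m
      prod-sucˡ s zero = begin
        1# * (1# - x ^ suc (s ℕ.+ 0)) ≈⟨ *-comm _ _ ⟩
        (1# - x ^ suc (s ℕ.+ 0)) * 1# ≡⟨ cong (λ t → (1# - x ^ suc t) * 1#) (ℕ.+-identityʳ s) ⟩
        (1# - x ^ suc s) * 1# ∎
      prod-sucˡ s (suc m) = begin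
        prod s (suc m) * (1# - x ^ suc (s ℕ.+ suc m)) ≈⟨ *-congʳ (prod-sucˡ s m) ⟩
        (1# - x ^ suc s) * prod (suc s) m * (1# - x ^ suc (s ℕ.+ suc m)) ≈⟨ *-assoc _ _ _ ⟩
        (1# - x ^ suc s) * (prod (suc s) m * (1# - x ^ suc (s ℕ.+ suc m)))
          ≡⟨ cong (λ t → (1# - x ^ suc s) * (prod (suc s) m * (1# - x ^ suc t))) (ℕ.+-suc s m) ⟩
        (1# - x ^ suc s) * (prod (suc s) m * (1# - x ^ suc (suc s ℕ.+ m))) ∎

      -- With n = s + m and P_k = (1 - x)...(1 - x^k), this is (-1)^s (P_n / P_s) x^(s n + s(s + 1)
      -- / 2); `prod s m` is the quotient P_n / P_s written without division.
      shanksTerm : ℕ → ℕ → Carrier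
      shanksTerm s m = ⟦ sgn s ⟧ * (prod s m * x ^ (s ℕ.* (s ℕ.+ m) ℕ.+ tri s))

      -- The terms of index at most s in Shanks' finite form, of order s + m, of the pentagonal theorem.
      shanks : ℕ → ℕ → Carrier
      shanks zero m = shanksTerm zero m
      shanks (suc s) m = shanks s (suc m) + shanksTerm (suc s) m

      -- Passing from order s + m to s + m + 1, the sums telescope.
      shanks-suc : ∀ s m → shanks s (suc m) ≈ shanks s m - shanksTerm s m * x ^ (suc s ℕ.+ s ℕ.+ m)
      shanks-suc zero m = solve 3 (λ c p y → c :* (p :* (one c :- y) :* one c) := c :* (p :* one c) :- c :*
          (p :* one c) :* y)
          refl ⟦ 1F ⟧ (prod 0 m) (x ^ suc m)
      shanks-suc (suc s) m = begin
        shanks s (suc (suc m)) + shanksTerm (suc s) (suc m)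
          ≈⟨ +-congʳ (shanks-suc s (suc m)) ⟩
        shanks s (suc m) - shanksTerm s (suc m) * x ^ (suc s ℕ.+ s ℕ.+ suc m) + shanksTerm (suc s) (suc m)
          ≈⟨ +-cong (+-congˡ (-‿cong (begin
              ⟦ sgn s ⟧ * (prod s (suc m) * x ^ (s ℕ.* (s ℕ.+ suc m) ℕ.+ tri s)) * x ^ (suc s ℕ.+ s ℕ.+ suc m)
                ≈⟨ trans (*-assoc _ _ _) (*-congˡ (trans (*-assoc _ _ _)
                    (*-cong (prod-sucˡ s m) (sym (^-homo-* x (s ℕ.* (s ℕ.+ suc m) ℕ.+ tri s)
                        (suc s ℕ.+ s ℕ.+ suc m)))))) ⟩
              ⟦ sgn s ⟧ * ((1# - x ^ suc s) * p * x ^ (s ℕ.* (s ℕ.+ suc m) ℕ.+ tri s ℕ.+ (suc s ℕ.+ s ℕ.+ suc m)))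
                ≡⟨ cong (λ e → ⟦ sgn s ⟧ * ((1# - x ^ suc s) * p * x ^ e)) (exponent₁ s m (tri s)) ⟩
              ⟦ sgn s ⟧ * ((1# - x ^ suc s) * p * y) ∎)))
             (begin
              ⟦ ⊖ sgn s ⟧ * (p * (1# - x ^ suc (suc s ℕ.+ m)) * x ^ (suc s ℕ.* (suc s ℕ.+ suc m) ℕ.+ tri (suc s)))
                ≈⟨ *-cong (-‿homo (sgn s)) (*-congˡ
                    (trans (reflexive (cong (x ^_) (exponent₂ s m (tri (suc s)))))
                        (^-homo-* x (suc s ℕ.* (suc s ℕ.+ m) ℕ.+ tri (suc s)) (suc s)))) ⟩
              - ⟦ sgn s ⟧ * (p * (1# - x ^ suc (suc s ℕ.+ m)) * (y * x ^ suc s)) ∎) ⟩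
        shanks s (suc m) - ⟦ sgn s ⟧ * ((1# - x ^ suc s) * p * y) + - ⟦ sgn s ⟧ *
            (p * (1# - x ^ suc (suc s ℕ.+ m)) * (y * x ^ suc s))
          -- Here a = x^(s+1) and b = x^(s+m+2). The two terms c p y a cancel, leaving the new
          -- summand - c p y and the next remainder c p y a b.
          ≈⟨ solve 6 (λ t c a p y b → t :- c :* ((one c :- a) :* p :* y) :+ :- c :* (p :* (one c :- b) :* (y :* a))
                := (t :+ :- c :* (p :* y)) :- :- c :* (p :* y) :* (a :* b)) refl (shanks s (suc m)) ⟦ sgn s ⟧
                    (x ^ suc s) p y (x ^ suc (suc s ℕ.+ m)) ⟩
        (shanks s (suc m) + - ⟦ sgn s ⟧ * (p * y)) - - ⟦ sgn s ⟧ * (p * y) * (x ^ suc s * x ^ suc (suc s ℕ.+ m))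
          ≈⟨ +-cong (+-congˡ (*-congʳ (sym (-‿homo (sgn s))))) (-‿cong (*-cong (*-congʳ (sym (-‿homo (sgn s))))
                (trans (sym (^-homo-* x (suc s) _)) (reflexive (cong (x ^_) (exponent₃ s m)))))) ⟩
        shanks s (suc m) + shanksTerm (suc s) m - shanksTerm (suc s) m * x ^ (suc (suc s) ℕ.+ suc s ℕ.+ m) ∎
        where
        p = prod (suc s) m
        y = x ^ (suc s ℕ.* (suc s ℕ.+ m) ℕ.+ tri (suc s))
        module N = +-*-Solver
        exponent₁ : ∀ s m t → s ℕ.* (s ℕ.+ suc m) ℕ.+ t ℕ.+ (suc s ℕ.+ s ℕ.+ suc m) ≡ suc s ℕ.*
            (suc s ℕ.+ m) ℕ.+ (suc s ℕ.+ t)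
        exponent₁ = N.solve 3 (λ s m t → s N.:* (s N.:+ (N.con 1 N.:+ m)) N.:+ t N.:+
            (N.con 1 N.:+ s N.:+ s N.:+ (N.con 1 N.:+ m)) N.:= (N.con 1 N.:+ s) N.:*
                (N.con 1 N.:+ s N.:+ m) N.:+ (N.con 1 N.:+ s N.:+ t)) ≡.refl
        exponent₂ : ∀ s m t → suc s ℕ.* (suc s ℕ.+ suc m) ℕ.+ t ≡ suc s ℕ.* (suc s ℕ.+ m) ℕ.+ t ℕ.+ suc s
        exponent₂ = N.solve 3 (λ s m t → (N.con 1 N.:+ s) N.:*
            (N.con 1 N.:+ s N.:+ (N.con 1 N.:+ m)) N.:+ t N.:= (N.con 1 N.:+ s) N.:*
                (N.con 1 N.:+ s N.:+ m) N.:+ t N.:+ (N.con 1 N.:+ s)) ≡.refl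
        exponent₃ : ∀ s m → suc s ℕ.+ suc (suc s ℕ.+ m) ≡ suc (suc s) ℕ.+ suc s ℕ.+ m
        exponent₃ = N.solve 2 (λ s m → N.con 1 N.:+ s N.:+
            (N.con 1 N.:+ (N.con 1 N.:+ s N.:+ m)) N.:= N.con 1 N.:+ (N.con 1 N.:+ s) N.:+
                (N.con 1 N.:+ s) N.:+ m) ≡.refl

      -- Raising the order from n to n + 1 adds two monomials: the telescoping remainder, at index
      -- 6n + 5, and the new last term, at index 6n + 7. At the other new indices 6n + 2, 6n + 3, 6n
      -- + 4 and 6n + 6 the character vanishes.
      shanks-pentagonal : ∀ n → shanks n 0 ≈ Σ< (2 ℕ.+ n ℕ.* 6) (λ k → ⟦ χ k ⟧ * x ^ pentagonal k)
      shanks-pentagonal zero = sym (begin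
        0# + ⟦ 0F ⟧ * 1# + ⟦ 1F ⟧ * 1# ≈⟨ +-cong (trans (+-identityˡ _) (trans (*-congʳ 0-homo) (zeroˡ 1#)))
            (*-congˡ (sym (*-identityˡ 1#))) ⟩
        0# + ⟦ 1F ⟧ * (1# * 1#) ≈⟨ +-identityˡ _ ⟩
        ⟦ 1F ⟧ * (1# * 1#) ∎)
      shanks-pentagonal (suc n) = begin
        shanks n 1 + shanksTerm (suc n) 0 ≈⟨ +-congʳ (shanks-suc n 0) ⟩
        shanks n 0 - shanksTerm n 0 * x ^ (suc n ℕ.+ n ℕ.+ 0) + shanksTerm (suc n) 0
          ≈⟨ +-cong (+-cong (shanks-pentagonal n) five) seven ⟩
        Σ< (2 ℕ.+ n ℕ.* 6) f + f (5 ℕ.+ n ℕ.* 6) + f (7 ℕ.+ n ℕ.* 6)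
          ≈⟨ +-congʳ (sym (trans (vanish 6 ≡.refl)
              (+-congʳ (trans (vanish 4 ≡.refl) (trans (vanish 3 ≡.refl) (vanish 2 ≡.refl)))))) ⟩
        Σ< (2 ℕ.+ suc n ℕ.* 6) f ∎
        where
        f : ℕ → Carrier
        f k = ⟦ χ k ⟧ * x ^ pentagonal k
        module N = +-*-Solver
        vanish : ∀ r → χ r ≡ 0F → ∀ {y} → y + f (r ℕ.+ n ℕ.* 6) ≈ y
        vanish r e {y} = begin
          y + ⟦ χ (r ℕ.+ n ℕ.* 6) ⟧ * _ ≈⟨ +-congˡ
              (*-congʳ (trans (reflexive (cong ⟦_⟧
                  (≡.trans (χ-r+6n r n) (≡.trans (cong (sgn n ⊗_) e) (⊗-zeroʳ (sgn n)))))) 0-homo)) ⟩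
          y + 0# * _ ≈⟨ +-congˡ (zeroˡ _) ⟩
          y + 0# ≈⟨ +-identityʳ y ⟩
          y ∎
        term≈ : ∀ r c e → sgn n ⊗ χ r ≡ c → (r ℕ.+ n ℕ.* 6) ℕ.* (r ℕ.+ n ℕ.* 6) ≡ suc (e ℕ.* 24) →
            ⟦ c ⟧ * x ^ e ≈ f (r ℕ.+ n ℕ.* 6)
        term≈ r c e ec ee = sym (*-cong (reflexive (cong ⟦_⟧ (≡.trans (χ-r+6n r n) ec)))
            (reflexive (cong (x ^_) (pentagonal-from (r ℕ.+ n ℕ.* 6) e ee))))
        minus : ∀ s → s ⊗ 2F ≡ ⊖ s
        minus s = ⊗-comm s 2F
        five : - (shanksTerm n 0 * x ^ (suc n ℕ.+ n ℕ.+ 0)) ≈ f (5 ℕ.+ n ℕ.* 6)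
        five = begin
          - (⟦ sgn n ⟧ * (1# * x ^ (n ℕ.* (n ℕ.+ 0) ℕ.+ tri n)) * x ^ (suc n ℕ.+ n ℕ.+ 0))
            ≈⟨ solve 3 (λ c a b → :- (c :* (one a :* a) :* b) := :- c :* (a :* b)) refl ⟦ sgn n ⟧
                (x ^ (n ℕ.* (n ℕ.+ 0) ℕ.+ tri n)) (x ^ (suc n ℕ.+ n ℕ.+ 0)) ⟩
          - ⟦ sgn n ⟧ * (x ^ (n ℕ.* (n ℕ.+ 0) ℕ.+ tri n) * x ^ (suc n ℕ.+ n ℕ.+ 0))
            ≈⟨ *-cong (sym (-‿homo (sgn n))) (trans
                (sym (^-homo-* x (n ℕ.* (n ℕ.+ 0) ℕ.+ tri n) (suc n ℕ.+ n ℕ.+ 0))) (reflexive (cong (x ^_)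
               (N.solve 2 (λ n t → n N.:* (n N.:+ N.con 0) N.:+ t N.:+
                   (N.con 1 N.:+ n N.:+ n N.:+ N.con 0) N.:= (N.con 1 N.:+ n) N.:*
                       (N.con 1 N.:+ n) N.:+ t) ≡.refl n (tri n))))) ⟩
          ⟦ ⊖ sgn n ⟧ * x ^ (suc n ℕ.* suc n ℕ.+ tri n)
            ≈⟨ term≈ 5 (⊖ sgn n) (suc n ℕ.* suc n ℕ.+ tri n) (minus (sgn n)) (square-5+6n n) ⟩
          f (5 ℕ.+ n ℕ.* 6) ∎
        seven : shanksTerm (suc n) 0 ≈ f (7 ℕ.+ n ℕ.* 6)
        seven = begin
          ⟦ sgn (suc n) ⟧ * (1# * x ^ (suc n ℕ.* (suc n ℕ.+ 0) ℕ.+ tri (suc n)))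
            ≈⟨ *-congˡ (trans (*-identityˡ _) (reflexive
                (cong (λ k → x ^ (suc n ℕ.* k ℕ.+ tri (suc n))) (ℕ.+-identityʳ (suc n))))) ⟩
          ⟦ sgn (suc n) ⟧ * x ^ (suc n ℕ.* suc n ℕ.+ tri (suc n))
            ≈⟨ term≈ 7 (sgn (suc n)) (suc n ℕ.* suc n ℕ.+ tri (suc n)) (minus (sgn n)) (square-1+6n (suc n)) ⟩
          f (7 ℕ.+ n ℕ.* 6) ∎

      ^-vanish : ∀ {N} → x ^ suc N ≈ 0# → ∀ {e} → N ℕ.< e → x ^ e ≈ 0#
      ^-vanish {N} x≈0 {e} N<e = begin
        x ^ e ≡⟨ cong (x ^_) (≡.sym (ℕ.m+[n∸m]≡n N<e)) ⟩
        x ^ (suc N ℕ.+ (e ℕ.∸ suc N)) ≈⟨ ^-homo-* x (suc N) _ ⟩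
        x ^ suc N * x ^ (e ℕ.∸ suc N) ≈⟨ trans (*-congʳ x≈0) (zeroˡ _) ⟩
        0# ∎

      prod-stable : ∀ {N} → x ^ suc N ≈ 0# → ∀ m → prod 0 (m ℕ.+ N) ≈ prod 0 N
      prod-stable x≈0 zero = refl
      prod-stable {N} x≈0 (suc m) = begin
        prod 0 (m ℕ.+ N) * (1# - x ^ suc (m ℕ.+ N)) ≈⟨ *-cong (prod-stable x≈0 m)
            (+-congˡ (-‿cong (^-vanish x≈0 (ℕ.s≤s (ℕ.m≤n+m N m))))) ⟩
        prod 0 N * (1# - 0#) ≈⟨ *-congˡ (trans (+-congˡ -0#≈0#) (+-identityʳ 1#)) ⟩
        prod 0 N * 1# ≈⟨ *-identityʳ _ ⟩
        prod 0 N ∎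

      -- A term of index s ≥ 1 carries the exponent s(s + m) + s(s + 1) / 2, which exceeds s + m, so
      -- nilpotency kills it. Only the term of index 0 survives, and that is the full product.
      shanks-truncated : ∀ s m → x ^ suc (s ℕ.+ m) ≈ 0# → shanks s m ≈ prod 0 (s ℕ.+ m)
      shanks-truncated zero m x≈0 = begin
        ⟦ 1F ⟧ * (prod 0 m * 1#) ≈⟨ *-cong 1-homo (*-identityʳ _) ⟩
        1# * prod 0 m ≈⟨ *-identityˡ _ ⟩
        prod 0 m ∎
      shanks-truncated (suc s) m x≈0 = begin
        shanks s (suc m) + shanksTerm (suc s) m
          ≈⟨ +-cong (shanks-truncated s (suc m) (subst (λ n → x ^ suc n ≈ 0#) (≡.sym (ℕ.+-suc s m)) x≈0))
               (*-congˡ (*-congˡ (^-vanish x≈0 big))) ⟩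
        prod 0 (s ℕ.+ suc m) + ⟦ sgn (suc s) ⟧ * (prod (suc s) m * 0#)
          ≈⟨ +-cong (reflexive (cong (prod 0) (ℕ.+-suc s m))) (trans (*-congˡ (zeroʳ _)) (zeroʳ _)) ⟩
        prod 0 (suc s ℕ.+ m) + 0# ≈⟨ +-identityʳ _ ⟩
        prod 0 (suc s ℕ.+ m) ∎
        where
        big : suc s ℕ.+ m ℕ.< suc s ℕ.* (suc s ℕ.+ m) ℕ.+ tri (suc s)
        big = ℕ.<-≤-trans (ℕ.m<m+n (suc s ℕ.+ m) (ℕ.s≤s ℕ.z≤n))
            (ℕ.+-monoˡ-≤ (tri (suc s)) (ℕ.m≤m+n (suc s ℕ.+ m) (s ℕ.* (suc s ℕ.+ m))))

      -- `shanks N 0` is evaluated twice: as the product, by nilpotency, and as the theta sum, by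
      -- telescoping.
      pentagonal-theorem : ∀ {N} → x ^ suc N ≈ 0# → prod 0 N ≈ Σ< (2 ℕ.+ N ℕ.* 6) (λ k → ⟦ χ k ⟧ * x ^ pentagonal k)
      pentagonal-theorem {N} x≈0 = begin
        prod 0 N ≡⟨ cong (prod 0) (≡.sym (ℕ.+-identityʳ N)) ⟩
        prod 0 (N ℕ.+ 0) ≈⟨ shanks-truncated N 0 (subst (λ n → x ^ suc n ≈ 0#) (≡.sym (ℕ.+-identityʳ N)) x≈0) ⟨
        shanks N 0 ≈⟨ shanks-pentagonal N ⟩
        _ ∎

      frobenius : ∀ k → (1# - x ^ k) ^ 3 ≈ 1# - (x ^ 3) ^ k
      frobenius k = begin
        (1# - x ^ k) ^ 3 ≈⟨ solve 1 (λ y → (one y :- y) :^ 3 := one y :- y :^ 3) refl (x ^ k) ⟩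
        1# - (x ^ k) ^ 3 ≈⟨ +-congˡ (-‿cong (trans (^-assocʳ x k 3)
            (trans (reflexive (cong (x ^_) (ℕ.*-comm k 3))) (sym (^-assocʳ x 3 k))))) ⟩
        1# - (x ^ 3) ^ k ∎

    open Powers

    prod-cube : ∀ x n → prod (x ^ 3) 0 n ≈ prod x 0 n * prod x 0 n * prod x 0 n
    prod-cube x zero = solve 1 (λ y → one y := one y :* one y :* one y) refl x
    prod-cube x (suc n) = begin
      prod (x ^ 3) 0 n * (1# - (x ^ 3) ^ suc n) ≈⟨ *-cong (prod-cube x n) (sym (frobenius x (suc n))) ⟩
      p * p * p * (1# - x ^ suc n) ^ 3 ≈⟨ solve 2 (λ p a → p :* p :* p :* a :^ 3 := p :* a :* (p :* a) :*
          (p :* a)) refl p (1# - x ^ suc n) ⟩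
      p * (1# - x ^ suc n) * (p * (1# - x ^ suc n)) * (p * (1# - x ^ suc n)) ∎
      where p = prod x 0 n

-- Generating functions of partitions without multiples of u, and the coefficients of B modulo 3.

module PartitionSeries where

  open import Defs
  open import Algebra.Bundles using (CommutativeRing)
  import Algebra.Properties.Semiring.Exp as Exp
  open import Data.Fin.Patterns
  open import Data.List using (map; upTo; applyUpTo)
  open import Data.List.Properties using (map-upTo)
  open import Data.Nat.ListAction using (sum)
  open import Data.Nat as ℕ using (ℕ; zero; suc; _≤_; _<_; s≤s; _∸_; _≤?_)
  open import Data.Nat.Divisibility using (_∣_; _∤_; _∣?_; n∣m*n; ∣m+n∣m⇒∣n; >⇒∤; 0∣⇒≡0)
  import Data.Nat.Properties as ℕ
  open import Data.Product using (Σ-syntax; _,_; proj₁; proj₂)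
  open import Function using (_∘_)
  open import Relation.Binary.PropositionalEquality as ≡ using (_≡_; refl; cong; cong₂; sym; trans; subst)
  open import Relation.Nullary using (¬_; Dec; yes; no; contradiction)
  open SeriesMod3
  open Pentagonal

  sumTo : ℕ → (ℕ → ℕ) → ℕ
  sumTo n t = sum (applyUpTo t n)

  sumTo-cong : ∀ n {s t} → (∀ j → s j ≡ t j) → sumTo n s ≡ sumTo n t
  sumTo-cong zero e = refl
  sumTo-cong (suc n) e = cong₂ ℕ._+_ (e 0) (sumTo-cong n (e ∘ suc))

  sumTo-zero : ∀ n {t} → (∀ j → t j ≡ 0) → sumTo n t ≡ 0
  sumTo-zero zero e = refl
  sumTo-zero (suc n) e = cong₂ ℕ._+_ (e 0) (sumTo-zero n (e ∘ suc))

  sumTo-extend : ∀ n r {t} → (∀ j → t (n ℕ.+ j) ≡ 0) → sumTo (n ℕ.+ r) t ≡ sumTo n t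
  sumTo-extend zero r e = sumTo-zero r e
  sumTo-extend (suc n) r {t} e = cong (t 0 ℕ.+_) (sumTo-extend n r e)

  partsLE-skip : ∀ u k m → u ∣ suc k → partsLE u (suc k) m ≡ partsLE u k m
  partsLE-skip u k m u∣k with u ∣? suc k
  ... | yes _ = refl
  ... | no u∤k = contradiction u∣k u∤k

  -- The witness is the summand that is local to the definition of partsLE.
  partsLE-unfold : ∀ u k m → u ∤ suc k → Σ[ t ∈ (ℕ → ℕ) ] partsLE u (suc k) m ≡ sum (map t (upTo (suc m)))
  partsLE-unfold u k m u∤k with u ∣? suc k
  ... | yes u∣k = contradiction u∣k u∤k
  ... | no _ = _ , refl

  -- A named copy of that local summand, about which statements can be made.
  withMultiplicity : ℕ → ℕ → ℕ → ℕ → ℕ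
  withMultiplicity u k m j with j ℕ.* suc k ≤? m
  ... | yes _ = partsLE u k (m ∸ j ℕ.* suc k)
  ... | no _ = 0

  partsLE-unfold-term : ∀ u k m (u∤k : u ∤ suc k) j → proj₁ (partsLE-unfold u k m u∤k) j ≡ withMultiplicity u k m j
  partsLE-unfold-term u k m u∤k j with u ∣? suc k
  ... | yes u∣k = contradiction u∣k u∤k
  ... | no _ with j ℕ.* suc k ≤? m
  ...   | yes _ = refl
  ...   | no _ = refl

  withMultiplicity-0 : ∀ u k m j → m < j ℕ.* suc k → withMultiplicity u k m j ≡ 0
  withMultiplicity-0 u k m j m< with j ℕ.* suc k ≤? m
  ... | yes ≤m = contradiction ≤m (ℕ.<⇒≱ m<)
  ... | no _ = refl

  withMultiplicity-suc : ∀ u k m j → withMultiplicity u k (suc k ℕ.+ m) (suc j) ≡ withMultiplicity u k m j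
  withMultiplicity-suc u k m j with j ℕ.* suc k ≤? m | suc j ℕ.* suc k ≤? suc k ℕ.+ m
  ... | yes _ | yes _ = cong (partsLE u k) (ℕ.[m+n]∸[m+o]≡n∸o (suc k) m (j ℕ.* suc k))
  ... | yes a | no b = contradiction (ℕ.+-monoʳ-≤ (suc k) a) b
  ... | no a | yes b = contradiction (ℕ.+-cancelˡ-≤ (suc k) _ _ b) a
  ... | no _ | no _ = refl

  partsLE-sum : ∀ u k m → u ∤ suc k → partsLE u (suc k) m ≡ sumTo (suc m) (withMultiplicity u k m)
  partsLE-sum u k m u∤k = trans (proj₂ (partsLE-unfold u k m u∤k))
    (trans (cong sum (map-upTo _ (suc m))) (sumTo-cong (suc m) (partsLE-unfold-term u k m u∤k)))

  partsLE-small : ∀ u k m → m < suc k → partsLE u (suc k) m ≡ partsLE u k m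
  partsLE-small u k m m<k = helper (u ∣? suc k)
    where
    helper : Dec (u ∣ suc k) → partsLE u (suc k) m ≡ partsLE u k m
    helper (yes u∣k) = partsLE-skip u k m u∣k
    helper (no u∤k) = trans (partsLE-sum u k m u∤k) (trans (cong (partsLE u k m ℕ.+_)
        (sumTo-zero m (λ j → withMultiplicity-0 u k m (suc j) (ℕ.<-≤-trans m<k (ℕ.m≤m+n (suc k) _)))))
      (ℕ.+-identityʳ _))

  -- The summand of multiplicity 0 splits off. Removing one copy of the part k + 1 lowers every
  -- other multiplicity by one and leaves the sum for `m`, followed by k terms that are 0 because
  -- their multiplicity is too large.
  partsLE-large : ∀ u k m → u ∤ suc k →
    partsLE u (suc k) (suc k ℕ.+ m) ≡ partsLE u k (suc k ℕ.+ m) ℕ.+ partsLE u (suc k) m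
  partsLE-large u k m u∤k = trans (partsLE-sum u k (suc k ℕ.+ m) u∤k)
    (cong (partsLE u k (suc k ℕ.+ m) ℕ.+_) (trans (sumTo-cong (suc k ℕ.+ m) (withMultiplicity-suc u k m))
      (trans (cong (λ n → sumTo (suc n) (withMultiplicity u k m)) (ℕ.+-comm k m))
      (trans (sumTo-extend (suc m) k {withMultiplicity u k m} (λ j → withMultiplicity-0 u k m (suc m ℕ.+ j)
          (ℕ.≤-trans (ℕ.m≤m+n (suc m) j) (ℕ.m≤m*n (suc m ℕ.+ j) (suc k)))))
        (sym (partsLE-sum u k m u∤k))))))

  partsLE-pnd : ∀ u k m → m ≤ k → partsLE u k m ≡ pnd u m
  partsLE-pnd u k m m≤k = subst (λ l → partsLE u l m ≡ pnd u m) (ℕ.m∸n+n≡m m≤k) (go (k ∸ m))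
    where
    go : ∀ r → partsLE u (r ℕ.+ m) m ≡ pnd u m
    go zero = refl
    go (suc r) = trans (partsLE-small u (r ℕ.+ m) m (s≤s (ℕ.m≤n+m m r))) (go r)

  δ : ℕ → ℕ → F₃
  δ e n with e ℕ.≟ n
  ... | yes _ = 1F
  ... | no _ = 0F

  δ-zero : ∀ {e n} → ¬ e ≡ n → δ e n ≡ 0F
  δ-zero {e} {n} e≢n with e ℕ.≟ n
  ... | yes e≡n = contradiction e≡n e≢n
  ... | no _ = refl

  δ-one : ∀ {e n} → e ≡ n → δ e n ≡ 1F
  δ-one {e} {n} e≡n with e ℕ.≟ n
  ... | yes _ = refl
  ... | no e≢n = contradiction e≡n e≢n

  δ-suc : ∀ e n → δ (suc e) (suc n) ≡ δ e n
  δ-suc e n with e ℕ.≟ n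
  ... | yes e≡n = δ-one (cong suc e≡n)
  ... | no e≢n = δ-zero (e≢n ∘ ℕ.suc-injective)

  Σ₃ : ℕ → (ℕ → F₃) → F₃
  Σ₃ zero f = 0F
  Σ₃ (suc n) f = Σ₃ n f ⊕ f n

  Σ₃-cong : ∀ n {f g} → (∀ k → k < n → f k ≡ g k) → Σ₃ n f ≡ Σ₃ n g
  Σ₃-cong zero e = refl
  Σ₃-cong (suc n) e = cong₂ _⊕_ (Σ₃-cong n (λ k k<n → e k (ℕ.m<n⇒m<1+n k<n))) (e n ℕ.≤-refl)

  cauchy : ∀ n f g → mod₃ (sumTo (suc n) (λ k → f k ℕ.* g (n ∸ k))) ≡ ((mod₃ ∘ f) ⋆ (mod₃ ∘ g)) n
  cauchy zero f g = trans (cong mod₃ (ℕ.+-identityʳ (f 0 ℕ.* g 0))) (mod₃-* (f 0) (g 0))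
  cauchy (suc n) f g = trans (mod₃-+ (f 0 ℕ.* g (suc n)) _)
      (cong₂ _⊕_ (mod₃-* (f 0) (g (suc n))) (cauchy n (f ∘ suc) g))

  B-cauchy : ∀ u v n → mod₃ (B u v n) ≡ ((mod₃ ∘ pnd u) ⋆ (mod₃ ∘ pnd v)) n
  B-cauchy u v n = trans (cong (mod₃ ∘ sum) (map-upTo (λ k → pnd u k ℕ.* pnd v (n ∸ k)) (suc n)))
      (cauchy n (pnd u) (pnd v))

  module GeneratingFunction (N : ℕ) where
    open Truncated N
    open Algebra₃ ring constants
    open Powers
    open CommutativeRing ring
      using (_*_; _-_; 1#; 0#; *-congˡ; *-congʳ; *-cong; +-congˡ; -‿cong; setoid; *-assoc; *-comm; *-identityʳ; semiring)
      renaming (refl to ≈-refl; trans to ≈-trans; sym to ≈-sym)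
    open Exp semiring
    open import Relation.Binary.Reasoning.Setoid setoid

    q^-below : ∀ k f {n} → n < k → (q ^ k * f) n ≡ 0F
    q^-below (suc k) f {zero} n<k = refl
    q^-below (suc k) f {suc n} (s≤s n<k) = trans (⋆-assoc q (q ^ k) f (suc n))
        (trans (q-⋆-suc (q ^ k ⋆ f) n) (q^-below k f n<k))

    q^-shift : ∀ k f n → (q ^ k * f) (k ℕ.+ n) ≡ f n
    q^-shift zero f n = const-⋆ 1F f n
    q^-shift (suc k) f n = trans (⋆-assoc q (q ^ k) f (suc k ℕ.+ n))
        (trans (q-⋆-suc (q ^ k ⋆ f) (k ℕ.+ n)) (q^-shift k f n))

    q^-coefficient : ∀ e n → (q ^ e) n ≡ δ e n
    q^-coefficient zero zero = refl
    q^-coefficient zero (suc n) = refl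
    q^-coefficient (suc e) zero = refl
    q^-coefficient (suc e) (suc n) = trans (q-⋆-suc (q ^ e) n) (trans (q^-coefficient e n) (sym (δ-suc e n)))

    q-nilpotent : q ^ suc N ≈ 0#
    q-nilpotent n n≤N = trans (q^-coefficient (suc N) n) (δ-zero (λ e → ℕ.<⇒≢ (s≤s n≤N) (sym e)))

    partsSeries : ℕ → ℕ → Series
    partsSeries u k m = mod₃ (partsLE u k m)

    -- Multiplication by 1 - q^(k+1) undoes the choice of the multiplicity of the part k + 1. From
    -- degree k + 1 on this is the recurrence `partsLE-large`; below, nothing is subtracted and the
    -- part k + 1 does not fit.
    partsSeries-step : ∀ u k → u ∤ suc k → partsSeries u (suc k) * (1# - q ^ suc k) ≈ partsSeries u k
    partsSeries-step u k u∤k = begin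
      L′ * (1# - q ^ suc k) ≈⟨ solve 2 (λ l a → l :* (one a :- a) := l :- a :* l) ≈-refl L′ (q ^ suc k) ⟩
      L′ - q ^ suc k * L′ ≈⟨ coefficients ⟩
      partsSeries u k ∎
      where
      L′ = partsSeries u (suc k)
      coefficients : L′ - q ^ suc k * L′ ≈ partsSeries u k
      coefficients n _ with n ℕ.<? suc k
      ... | yes n<k = trans (cong₂ (λ x y → x ⊕ ⊖ y) (cong mod₃ (partsLE-small u k n n<k))
          (q^-below (suc k) L′ n<k)) (⊕-identityʳ _)
      ... | no n≮k = subst (λ n → L′ n ⊕ ⊖ (q ^ suc k * L′) n ≡ partsSeries u k n) (ℕ.m+[n∸m]≡n (ℕ.≮⇒≥ n≮k))
          (trans (cong₂ (λ x y → x ⊕ ⊖ y)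
              (trans (cong mod₃ (partsLE-large u k m u∤k)) (mod₃-+ (partsLE u k (suc k ℕ.+ m)) (partsLE u (suc k) m)))
              (q^-shift (suc k) L′ m))
            (trans (⊕-assoc (partsSeries u k (suc k ℕ.+ m)) (L′ m) (⊖ L′ m))
                (trans (cong (partsSeries u k (suc k ℕ.+ m) ⊕_) (⊖-inverseʳ (L′ m))) (⊕-identityʳ _))))
        where m = n ∸ suc k

    multiplesProd : ℕ → ℕ → Series
    multiplesProd u zero = 1#
    multiplesProd u (suc k) with u ∣? suc k
    ... | yes _ = multiplesProd u k * (1# - q ^ suc k)
    ... | no _ = multiplesProd u k

    multiplesProd-multiple : ∀ u k → u ∣ suc k → multiplesProd u (suc k) ≡ multiplesProd u k * (1# - q ^ suc k)
    multiplesProd-multiple u k u∣k with u ∣? suc k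
    ... | yes _ = refl
    ... | no u∤k = contradiction u∣k u∤k

    multiplesProd-nonmultiple : ∀ u k → u ∤ suc k → multiplesProd u (suc k) ≡ multiplesProd u k
    multiplesProd-nonmultiple u k u∤k with u ∣? suc k
    ... | yes u∣k = contradiction u∣k u∤k
    ... | no _ = refl

    -- The generating function is the product of 1 / (1 - q^i) over i ≤ k with u ∤ i. Multiplying by
    -- all factors 1 - q^i leaves those with u ∣ i, which avoids division.
    partsSeries-prod : ∀ u k → partsSeries u k * prod q 0 k ≈ multiplesProd u k
    partsSeries-prod u zero = ≈-trans (*-identityʳ (partsSeries u 0)) λ { zero _ → refl ; (suc n) _ → refl }
    partsSeries-prod u (suc k) = step (u ∣? suc k)
      where
      step : Dec (u ∣ suc k) → partsSeries u (suc k) * prod q 0 (suc k) ≈ multiplesProd u (suc k)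
      step (yes u∣k) = begin
        partsSeries u (suc k) * (prod q 0 k * (1# - q ^ suc k))
          ≈⟨ *-congʳ {x = prod q 0 k * (1# - q ^ suc k)} (λ n _ → cong mod₃ (partsLE-skip u k n u∣k)) ⟩
        partsSeries u k * (prod q 0 k * (1# - q ^ suc k)) ≈⟨ *-assoc (partsSeries u k) (prod q 0 k) (1# - q ^ suc k) ⟨
        partsSeries u k * prod q 0 k * (1# - q ^ suc k) ≈⟨ *-congʳ {x = 1# - q ^ suc k} (partsSeries-prod u k) ⟩
        multiplesProd u k * (1# - q ^ suc k) ≡⟨ multiplesProd-multiple u k u∣k ⟨
        multiplesProd u (suc k) ∎
      step (no u∤k) = begin
        partsSeries u (suc k) * (prod q 0 k * (1# - q ^ suc k))
          ≈⟨ solve 3 (λ l p a → l :* (p :* a) := l :* a :* p) ≈-refl (partsSeries u (suc k)) (prod q 0 k)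
              (1# - q ^ suc k) ⟩
        partsSeries u (suc k) * (1# - q ^ suc k) * prod q 0 k ≈⟨ *-congʳ {x = prod q 0 k} (partsSeries-step u k u∤k) ⟩
        partsSeries u k * prod q 0 k ≈⟨ partsSeries-prod u k ⟩
        multiplesProd u k ≡⟨ multiplesProd-nonmultiple u k u∤k ⟨
        multiplesProd u (suc k) ∎

    -- No positive integer is a multiple of 0, so u = 0 gives the series of all partitions; this
    -- lemma makes it the inverse of the full product, by which f₁ is cancelled below.
    multiplesProd-none : ∀ k → multiplesProd 0 k ≈ 1#
    multiplesProd-none zero = ≈-refl
    multiplesProd-none (suc k) with 0 ∣? suc k
    ... | yes 0∣k = contradiction (0∣⇒≡0 0∣k) λ ()
    ... | no _ = multiplesProd-none k

    multiplesProd-gap : ∀ u n r → r ≤ u → multiplesProd (suc u) (r ℕ.+ n ℕ.* suc u) ≈ multiplesProd (suc u)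
        (n ℕ.* suc u)
    multiplesProd-gap u n zero r≤u = ≈-refl
    multiplesProd-gap u n (suc r) r<u with suc u ∣? suc r ℕ.+ n ℕ.* suc u
    ... | yes u∣ = contradiction (∣m+n∣m⇒∣n (subst (suc u ∣_) (ℕ.+-comm (suc r) (n ℕ.* suc u)) u∣) (n∣m*n n))
        (>⇒∤ (s≤s r<u))
    ... | no _ = multiplesProd-gap u n r (ℕ.<⇒≤ r<u)

    multiplesProd-prod : ∀ u n → multiplesProd (suc u) (n ℕ.* suc u) ≈ prod (q ^ suc u) 0 n
    multiplesProd-prod u zero = ≈-refl
    multiplesProd-prod u (suc n) with suc u ∣? suc n ℕ.* suc u
    ... | no u∤ = contradiction (n∣m*n (suc n)) u∤
    ... | yes _ = *-cong (≈-trans (multiplesProd-gap u n u ℕ.≤-refl) (multiplesProd-prod u n))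
        (+-congˡ {x = 1#} (-‿cong (≈-sym (≈-trans (^-assocʳ q (suc u) (suc n))
            (^-congʳ q (ℕ.*-comm (suc u) (suc n)))))))

    pndSeries : ℕ → Series
    pndSeries u n = mod₃ (pnd u n)

    F : Series
    F = prod q 0 N

    -- Raising the bound on the parts from N to N(u + 1) changes no coefficient up to degree N, and
    -- exactly N multiples of u + 1 lie within the new bound.
    pndSeries-prod : ∀ u → pndSeries (suc u) * F ≈ prod (q ^ suc u) 0 N
    pndSeries-prod u = begin
      pndSeries (suc u) * F
        ≈⟨ *-cong {pndSeries (suc u)} {partsSeries (suc u) (N ℕ.* suc u)} {F} {prod q 0 (N ℕ.* suc u)}
             (λ n n≤N → cong mod₃ (sym (partsLE-pnd (suc u) (N ℕ.* suc u) n (ℕ.≤-trans n≤N (ℕ.m≤m*n N (suc u))))))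
             (subst (λ k → F ≈ prod q 0 k) (ℕ.m∸n+n≡m (ℕ.m≤m*n N (suc u)))
                 (≈-sym (prod-stable q q-nilpotent (N ℕ.* suc u ∸ N)))) ⟩
      partsSeries (suc u) (N ℕ.* suc u) * prod q 0 (N ℕ.* suc u) ≈⟨ partsSeries-prod (suc u) (N ℕ.* suc u) ⟩
      multiplesProd (suc u) (N ℕ.* suc u) ≈⟨ multiplesProd-prod u N ⟩
      prod (q ^ suc u) 0 N ∎

    -- f₃ ≡ f₁³ (mod 3), and f₁ can be cancelled.
    pndSeries-3 : pndSeries 3 ≈ F * F
    pndSeries-3 = begin
      P ≈⟨ solve 1 (λ p → p := p :* one p) ≈-refl P ⟩
      P * 1# ≈⟨ *-congˡ {x = P} (≈-trans (≈-sym (multiplesProd-none N)) (≈-sym (partsSeries-prod 0 N))) ⟩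
      P * (I * F) ≈⟨ solve 3 (λ p i f → p :* (i :* f) := p :* f :* i) ≈-refl P I F ⟩
      P * F * I ≈⟨ *-congʳ {x = I} (≈-trans (pndSeries-prod 2) (prod-cube q N)) ⟩
      F * F * F * I ≈⟨ solve 2 (λ f i → f :* f :* f :* i := f :* f :* (i :* f)) ≈-refl F I ⟩
      F * F * (I * F) ≈⟨ *-congˡ {x = F * F} (≈-trans (partsSeries-prod 0 N) (multiplesProd-none N)) ⟩
      F * F * 1# ≈⟨ solve 1 (λ p → p :* one p := p) ≈-refl (F * F) ⟩
      F * F ∎
      where
      P = pndSeries 3
      I = partsSeries 0 N

    pndSeries-product : ∀ v → pndSeries 3 * pndSeries (suc v) ≈ F * prod (q ^ suc v) 0 N
    pndSeries-product v = begin
      pndSeries 3 * P ≈⟨ *-congʳ {x = P} pndSeries-3 ⟩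
      F * F * P ≈⟨ solve 2 (λ f p → f :* f :* p := f :* (p :* f)) ≈-refl F P ⟩
      F * (P * F) ≈⟨ *-congˡ {x = F} (pndSeries-prod v) ⟩
      F * prod (q ^ suc v) 0 N ∎
      where P = pndSeries (suc v)

    Σ<-coefficient : ∀ M f n → Σ< M f n ≡ Σ₃ M (λ k → f k n)
    Σ<-coefficient zero f n = refl
    Σ<-coefficient (suc M) f n = cong (_⊕ f M n) (Σ<-coefficient M f n)

    q^v-nilpotent : ∀ v → (q ^ suc v) ^ suc N ≈ 0#
    q^v-nilpotent v = ≈-trans (^-assocʳ q (suc v) (suc N)) (^-vanish q q-nilpotent (ℕ.m≤n*m (suc N) (suc v)))

    term-coefficient : ∀ v x y n → n ≤ N → ((const (χ x) * q ^ pentagonal x) *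
        (const (χ y) * (q ^ v) ^ pentagonal y)) n
      ≡ χ x ⊗ χ y ⊗ δ (pentagonal x ℕ.+ v ℕ.* pentagonal y) n
    term-coefficient v x y n n≤N = trans (rearrange n n≤N)
        (trans (const-⋆ (χ x) _ n) (trans (cong (χ x ⊗_)
            (trans (const-⋆ (χ y) (q ^ e) n) (cong (χ y ⊗_) (q^-coefficient e n))))
        (sym (⊗-assoc (χ x) (χ y) (δ e n)))))
      where
      e = pentagonal x ℕ.+ v ℕ.* pentagonal y
      rearrange : (const (χ x) * q ^ pentagonal x) * (const (χ y) * (q ^ v) ^ pentagonal y) ≈ const (χ x) *
          (const (χ y) * q ^ e)
      rearrange = begin
        const (χ x) * q ^ pentagonal x * (const (χ y) * (q ^ v) ^ pentagonal y)
          ≈⟨ *-congˡ {x = const (χ x) * q ^ pentagonal x} (*-congˡ {x = const (χ y)} (^-assocʳ q v (pentagonal y))) ⟩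
        const (χ x) * q ^ pentagonal x * (const (χ y) * q ^ (v ℕ.* pentagonal y))
          ≈⟨ solve 4 (λ c a d b → c :* a :* (d :* b) := c :* (d :* (a :* b))) ≈-refl (const (χ x))
              (q ^ pentagonal x) (const (χ y)) (q ^ (v ℕ.* pentagonal y)) ⟩
        const (χ x) * (const (χ y) * (q ^ pentagonal x * q ^ (v ℕ.* pentagonal y)))
          ≈⟨ *-congˡ {x = const (χ x)} (*-congˡ {x = const (χ y)}
              (≈-sym (^-homo-* q (pentagonal x) (v ℕ.* pentagonal y)))) ⟩
        const (χ x) * (const (χ y) * q ^ e) ∎

    M : ℕ
    M = 2 ℕ.+ N ℕ.* 6

    -- The order N may exceed n. This only widens the box of pairs (x, y), and the split case uses a
    -- box large enough to hold every solution of x² + D y² = 24 n + 1 + D.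
    B-coefficient : ∀ v n → n ≤ N → mod₃ (B 3 (suc v) n)
      ≡ Σ₃ M (λ x → Σ₃ M (λ y → χ x ⊗ χ y ⊗ δ (pentagonal x ℕ.+ suc v ℕ.* pentagonal y) n))
    B-coefficient v n n≤N = trans (B-cauchy 3 (suc v) n) (trans (expand n n≤N)
      (trans (Σ<-coefficient M _ n) (Σ₃-cong M (λ x _ → trans (Σ<-coefficient M _ n)
          (Σ₃-cong M (λ y _ → term-coefficient (suc v) x y n n≤N))))))
      where
      f g : ℕ → Series
      f x = const (χ x) * q ^ pentagonal x
      g y = const (χ y) * (q ^ suc v) ^ pentagonal y
      expand : pndSeries 3 * pndSeries (suc v) ≈ Σ< M (λ x → Σ< M (λ y → f x * g y))
      expand = begin
        pndSeries 3 * pndSeries (suc v) ≈⟨ pndSeries-product v ⟩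
        F * prod (q ^ suc v) 0 N ≈⟨ *-cong (pentagonal-theorem q {N} q-nilpotent)
            (pentagonal-theorem (q ^ suc v) {N} (q^v-nilpotent v)) ⟩
        Σ< M f * Σ< M g ≈⟨ Σ<-*ʳ M (Σ< M g) f ⟩
        Σ< M (λ x → f x * Σ< M g) ≈⟨ Σ<-cong M (λ x → Σ<-*ˡ M (f x) g) ⟩
        Σ< M (λ x → Σ< M (λ y → f x * g y)) ∎

-- Representations by x² + D y², and their absence when p is inert.

module Representations where

  open import Defs
  open import Data.Fin.Patterns
  open import Data.Fin.Properties using () renaming (_≟_ to _≟ᶠ_)
  open import Data.Nat
  open import Data.Nat.Coprimality using (Coprime; coprime-Bézout)
  open import Data.Nat.Divisibility
  open import Data.Nat.DivMod using (m≡m%n+[m/n]*n; m%n<n)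
  open import Data.Nat.GCD using (module Bézout)
  open import Data.Nat.Primality using (Prime; euclidsLemma; prime⇒nonZero; prime⇒irreducible)
  open import Data.Nat.Properties
  open import Data.Nat.Solver using (module +-*-Solver)
  open import Data.Product using (Σ-syntax; _,_; proj₁)
  open import Data.Sum using (inj₁; inj₂)
  open import Function using (_∘_)
  open import Relation.Binary.PropositionalEquality
  open import Relation.Nullary using (¬_; yes; no; contradiction)
  open +-*-Solver using (solve; con; _:=_; _:+_; _:*_)
  open SeriesMod3
  open Pentagonal
  open PartitionSeries

  -- A non-zero χ x forces x ≡ ±1 (mod 6), and there 24 divides x² - 1, so the division in
  -- `pentagonal` is exact.
  χ≢0⇒square : ∀ x → χ x ≢ 0F → x * x ≡ 1 + pentagonal x * 24
  χ≢0⇒square x χx≢0 = subst (λ x → χ x ≢ 0F → x * x ≡ 1 + pentagonal x * 24) (sym (m≡m%n+[m/n]*n x 6))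
      (go (x / 6) (x % 6) (m%n<n x 6)) χx≢0
    where
    vanishing : ∀ k r {A : Set} → χ r ≡ 0F → χ (r + k * 6) ≢ 0F → A
    vanishing k r e ne = contradiction (trans (χ-r+6n r k) (trans (cong (sgn k ⊗_) e) (⊗-zeroʳ (sgn k)))) ne
    square : ∀ x e → x * x ≡ suc (e * 24) → x * x ≡ 1 + pentagonal x * 24
    square x e eq = trans eq (cong (λ t → 1 + t * 24) (sym (pentagonal-from x e eq)))
    go : ∀ k r → r < 6 → χ (r + k * 6) ≢ 0F → (r + k * 6) * (r + k * 6) ≡ 1 + pentagonal (r + k * 6) * 24
    go k 0 _ ne = vanishing k 0 refl ne
    go k 1 _ ne = square (1 + k * 6) (k * k + tri k) (square-1+6n k)
    go k 2 _ ne = vanishing k 2 refl ne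
    go k 3 _ ne = vanishing k 3 refl ne
    go k 4 _ ne = vanishing k 4 refl ne
    go k 5 _ ne = square (5 + k * 6) (suc k * suc k + tri k) (square-5+6n k)
    go k (suc (suc (suc (suc (suc (suc r)))))) (s≤s (s≤s (s≤s (s≤s (s≤s (s≤s ())))))) ne

  module Weights (D n : ℕ) where

    Representation : ℕ → ℕ → Set
    Representation x y = x * x + D * (y * y) ≡ 24 * n + (1 + D)

    weight : ℕ → ℕ → F₃
    weight x y = χ x ⊗ χ y ⊗ δ (pentagonal x + D * pentagonal y) n

    module _ x y (χx≢0 : χ x ≢ 0F) (χy≢0 : χ y ≢ 0F) where

      form-pentagonal : x * x + D * (y * y) ≡ 24 * (pentagonal x + D * pentagonal y) + (1 + D)
      form-pentagonal = trans (cong₂ (λ s t → s + D * t) (χ≢0⇒square x χx≢0) (χ≢0⇒square y χy≢0))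
        (solve 3 (λ d s t → con 1 :+ s :* con 24 :+ d :* (con 1 :+ t :* con 24) := con 24 :* (s :+ d :* t) :+
            (con 1 :+ d)) refl D (pentagonal x) (pentagonal y))

      weight-representation : Representation x y → weight x y ≡ χ x ⊗ χ y
      weight-representation rep = trans (cong (χ x ⊗ χ y ⊗_) (δ-one
        (*-cancelˡ-≡ _ _ 24 (+-cancelʳ-≡ (1 + D) _ _ (trans (sym form-pentagonal) rep))))) (⊗-identityʳ (χ x ⊗ χ y))

    -- Either a factor χ vanishes, or both exponents are true pentagonal numbers; then total
    -- exponent n, multiplied by 24 with squares completed, would be a representation.
    weight-zero : ∀ x y → ¬ Representation x y → weight x y ≡ 0F
    weight-zero x y ¬rep with χ x ≟ᶠ 0F | χ y ≟ᶠ 0F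
    ... | yes χx≡0 | _ = cong (λ c → c ⊗ χ y ⊗ δ (pentagonal x + D * pentagonal y) n) χx≡0
    ... | no _ | yes χy≡0 = trans (cong (λ c → χ x ⊗ c ⊗ δ (pentagonal x + D * pentagonal y) n) χy≡0)
        (cong (_⊗ δ (pentagonal x + D * pentagonal y) n) (⊗-zeroʳ (χ x)))
    ... | no χx≢0 | no χy≢0 = trans (cong (χ x ⊗ χ y ⊗_)
        (δ-zero λ e → ¬rep (trans (form-pentagonal x y χx≢0 χy≢0) (cong (λ t → 24 * t + (1 + D)) e))))
            (⊗-zeroʳ (χ x ⊗ χ y))

  Σ₃-zero : ∀ n {f} → (∀ k → k < n → f k ≡ 0F) → Σ₃ n f ≡ 0F
  Σ₃-zero zero e = refl
  Σ₃-zero (suc n) e = cong₂ _⊕_ (Σ₃-zero n (λ k k<n → e k (m<n⇒m<1+n k<n))) (e n ≤-refl)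

  Σ₃-single : ∀ n {f} a → a < n → (∀ k → k < n → k ≢ a → f k ≡ 0F) → Σ₃ n f ≡ f a
  Σ₃-single (suc n) {f} a a≤n e with n ≟ a
  ... | yes refl = cong (_⊕ f n) (Σ₃-zero n (λ k k<n → e k (m<n⇒m<1+n k<n) (<⇒≢ k<n)))
  ... | no n≢a = trans (cong₂ _⊕_
      (Σ₃-single n a (≤∧≢⇒< (s≤s⁻¹ a≤n) (n≢a ∘ sym)) (λ k k<n → e k (m<n⇒m<1+n k<n))) (e n ≤-refl n≢a))
          (⊕-identityʳ (f a))

  Σ₃-pair : ∀ n {f} a b → a < n → b < n → a ≢ b → (∀ k → k ≢ a → k ≢ b → f k ≡ 0F) → Σ₃ n f ≡ f a ⊕ f b
  Σ₃-pair (suc n) {f} a b a≤n b≤n a≢b e with n ≟ a | n ≟ b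
  ... | yes refl | yes refl = contradiction refl a≢b
  ... | yes refl | no n≢b = trans (cong (_⊕ f n)
      (Σ₃-single n b (≤∧≢⇒< (s≤s⁻¹ b≤n) (n≢b ∘ sym)) (λ k k<n k≢b → e k (<⇒≢ k<n) k≢b))) (⊕-comm (f b) (f n))
  ... | no n≢a | yes refl = cong (_⊕ f n)
      (Σ₃-single n a (≤∧≢⇒< (s≤s⁻¹ a≤n) (n≢a ∘ sym)) (λ k k<n k≢a → e k k≢a (<⇒≢ k<n)))
  ... | no n≢a | no n≢b = trans (cong₂ _⊕_
      (Σ₃-pair n a b (≤∧≢⇒< (s≤s⁻¹ a≤n) (n≢a ∘ sym)) (≤∧≢⇒< (s≤s⁻¹ b≤n) (n≢b ∘ sym)) a≢b e) (e n n≢a n≢b))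
          (⊕-identityʳ (f a ⊕ f b))

  no-representation⇒3∣B : ∀ v n → (∀ x y → ¬ Weights.Representation (suc v) n x y) → 3 ∣ B 3 (suc v) n
  no-representation⇒3∣B v n none = mod₃≡0⇒3∣ (B 3 (suc v) n) (trans (GeneratingFunction.B-coefficient n v n ≤-refl)
    (Σ₃-zero M (λ x _ → Σ₃-zero M (λ y _ → Weights.weight-zero (suc v) n x y (none x y)))))
    where M = GeneratingFunction.M n

  prime∣square : ∀ {p x} → Prime p → p ∣ x * x → p ∣ x
  prime∣square {p} {x} pp p∣xx with euclidsLemma x x pp p∣xx
  ... | inj₁ h = h
  ... | inj₂ h = h

  module Inert {p} (pp : Prime p) (D : ℕ) (inert : ∀ z → p ∤ z * z + D) where

    private instance
      p≢0 : NonZero p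
      p≢0 = prime⇒nonZero pp

    -- If p ∤ y, then x / y modulo p would be a square root of -D.
    inert-∣ʸ : ∀ x y → p ∣ x * x + D * (y * y) → p ∣ y
    inert-∣ʸ x y p∣form with p ∣? y
    ... | yes p∣y = p∣y
    ... | no p∤y = contradiction p∣ (inert (x * proj₁ inverse))
      where
      coprime : Coprime p y
      coprime {d} (d∣p , d∣y) with prime⇒irreducible pp d∣p
      ... | inj₁ d≡1 = d≡1
      ... | inj₂ refl = contradiction d∣y p∤y
      -- Bézout over the naturals yields y′ y ≡ ±1 with the sign out of control. The square is 1
      -- either way, and only the square is used.
      inverse : Σ[ y′ ∈ ℕ ] Σ[ m ∈ ℕ ] Σ[ l ∈ ℕ ] (y′ * y) * (y′ * y) + m * p ≡ 1 + l * p
      inverse with coprime-Bézout coprime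
      ... | Bézout.+- k y′ eq = y′ , k , y′ * y * k , trans (cong (y′ * y * (y′ * y) +_) (sym eq))
          (trans (solve 1 (λ w → w :* w :+ (con 1 :+ w) := con 1 :+ w :* (con 1 :+ w)) refl (y′ * y))
          (cong suc (trans (cong (y′ * y *_) eq) (sym (*-assoc (y′ * y) k p)))))
      ... | Bézout.-+ k y′ eq = y′ , 0 , k * p * k + 2 * k , trans (cong (λ w → w * w + 0 * p) (sym eq))
          (solve 2 (λ k p → (con 1 :+ k :* p) :* (con 1 :+ k :* p) :+ con 0 :* p := con 1 :+
              (k :* p :* k :+ con 2 :* k) :* p) refl k p)
      p∣ : p ∣ (x * proj₁ inverse) * (x * proj₁ inverse) + D
      p∣ with y′ , m , l , eq ← inverse = ∣m+n∣m⇒∣n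
        (subst (p ∣_) identity (∣m∣n⇒∣m+n (∣n⇒∣m*n (y′ * y′) p∣form) (n∣m*n (D * m))))
        (n∣m*n (D * l))
        where
        identity : y′ * y′ * (x * x + D * (y * y)) + D * m * p ≡ D * l * p + (x * y′ * (x * y′) + D)
        identity = trans
          (solve 6 (λ x y w D m p → w :* w :* (x :* x :+ D :* (y :* y)) :+ D :* m :* p := x :* w :*
              (x :* w) :+ D :* (w :* y :* (w :* y) :+ m :* p)) refl x y y′ D m p)
          (trans (cong (λ t → x * y′ * (x * y′) + D * t) eq)
          (solve 4 (λ s D l p → s :+ D :* (con 1 :+ l :* p) := D :* l :* p :+ (s :+ D)) refl
              (x * y′ * (x * y′)) D l p))

    inert-∣ˣ : ∀ x y → p ∣ x * x + D * (y * y) → p ∣ x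
    inert-∣ˣ x y p∣form = prime∣square pp (∣m+n∣m⇒∣n (subst (p ∣_) (+-comm (x * x) (D * (y * y))) p∣form)
      (∣n⇒∣m*n D (∣m⇒∣m*n y (inert-∣ʸ x y p∣form))))

    -- Descent by two powers at a time: p divides x and y, hence p² divides the form, and (x / p, y
    -- / p) represents the number with exponent lowered by 2. An odd exponent ends at 1, where p
    -- would divide c m.
    odd-power-not-represented : ∀ c m → p ∤ c → p ∤ m → ∀ α x y → x * x + D * (y * y) ≢ c * (p ^ (2 * α + 1) * m)
    odd-power-not-represented c m p∤c p∤m = go
      where
      divisible : ∀ e x y → x * x + D * (y * y) ≡ c * (p ^ suc e * m) →
        Σ[ x′ ∈ ℕ ] Σ[ y′ ∈ ℕ ] p * (x′ * x′ + D * (y′ * y′)) ≡ c * (p ^ e * m)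
      divisible e x y eq with inert-∣ˣ x y p∣form | inert-∣ʸ x y p∣form
        where
        p∣form : p ∣ x * x + D * (y * y)
        p∣form = subst (p ∣_) (sym eq) (∣n⇒∣m*n c (∣m⇒∣m*n m (m∣m*n (p ^ e))))
      ... | divides x′ refl | divides y′ refl = x′ , y′ , *-cancelˡ-≡ _ _ p (trans
          (solve 4 (λ x y D p → p :* (p :* (x :* x :+ D :* (y :* y))) := x :* p :* (x :* p) :+ D :*
              (y :* p :* (y :* p))) refl x′ y′ D p)
          (trans eq (solve 4 (λ c p q m → c :* (p :* q :* m) := p :* (c :* (q :* m))) refl c p (p ^ e) m)))
      go : ∀ α x y → x * x + D * (y * y) ≢ c * (p ^ (2 * α + 1) * m)
      go zero x y eq with x′ , y′ , eq′ ← divisible 0 x y eq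
        with euclidsLemma c (p ^ 0 * m) pp (subst (p ∣_) eq′ (m∣m*n _))
      ... | inj₁ p∣c = p∤c p∣c
      ... | inj₂ p∣m = p∤m (subst (p ∣_) (*-identityˡ m) p∣m)
      go (suc α) x y eq with x′ , y′ , eq′ ← divisible (suc (2 * α + 1)) x y
          (trans eq (cong (λ e → c * (p ^ e * m)) (cong (_+ 1) (*-suc 2 α)))) =
        go α x′ y′ (*-cancelˡ-≡ _ _ p (trans eq′ (solve 4
            (λ c p q m → c :* (p :* q :* m) := p :* (c :* (q :* m))) refl c p (p ^ (2 * α + 1)) m)))

-- The representations of (1 + D) p when p = a² + D b².

module UniqueRepresentation where

  open import Data.Integer as ℤ using (ℤ; +_; -[1+_]; ∣_∣)
  import Data.Integer.Properties as ℤ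
  import Data.Integer.Divisibility.Signed as ℤᵈ
  open import Data.Integer.Solver using (module +-*-Solver)
  open import Data.Nat
  open import Data.Nat.Divisibility
  open import Data.Nat.Primality using (Prime; euclidsLemma; prime⇒nonZero)
  open import Data.Nat.Properties
  open import Data.Product using (_×_; _,_; proj₁; proj₂)
  open import Data.Sum using (_⊎_; inj₁; inj₂)
  open import Relation.Binary.PropositionalEquality
  open import Relation.Nullary using (contradiction)
  open +-*-Solver using (solve; con; _:=_; _:+_; _:*_; _:-_; :-_)
  open Representations using (prime∣square)

  ∣i∣² : ∀ i → + (∣ i ∣ * ∣ i ∣) ≡ i ℤ.* i
  ∣i∣² (+ n) = ℤ.pos-* n n
  ∣i∣² -[1+ n ] = refl

  ∣i∣≡1 : ∀ i → ∣ i ∣ ≡ 1 → i ≡ + 1 ⊎ i ≡ -[1+ 0 ]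
  ∣i∣≡1 (+ .1) refl = inj₁ refl
  ∣i∣≡1 -[1+ .0 ] refl = inj₂ refl

  form-pos : ∀ D x y → + (∣ x ∣ * ∣ x ∣ + D * (∣ y ∣ * ∣ y ∣)) ≡ x ℤ.* x ℤ.+ + D ℤ.* (y ℤ.* y)
  form-pos D x y = trans (ℤ.pos-+ (∣ x ∣ * ∣ x ∣) _)
      (cong₂ ℤ._+_ (∣i∣² x) (trans (ℤ.pos-* D _) (cong (+ D ℤ.*_) (∣i∣² y))))

  -- For s = 0 the number 1 + D would be a square, and for s ≥ 2 already D s² ≥ 4 D > 1 + D.
  small-form : ∀ D t s → 1 ≤ D → (∀ r → r * r ≢ 1 + D) → t * t + D * (s * s) ≡ 1 + D → t ≡ 1 × s ≡ 1
  small-form D t 0 D≥1 nonsquare eq = contradiction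
      (trans (sym (trans (cong (λ e → t * t + e) (*-zeroʳ D)) (+-identityʳ (t * t)))) eq) (nonsquare t)
  small-form D t 1 D≥1 nonsquare eq = t≡1 t (+-cancelʳ-≡ D (t * t) 1
      (trans (cong (λ e → t * t + e) (sym (*-identityʳ D))) eq)) , refl
    where
    t≡1 : ∀ t → t * t ≡ 1 → t ≡ 1
    t≡1 t e = m*n≡1⇒m≡1 t t e
  small-form D t (suc (suc s)) D≥1 nonsquare eq = contradiction eq (>⇒≢ (begin-strict
    1 + D ≤⟨ +-monoˡ-≤ D D≥1 ⟩
    D + D <⟨ m<m+n (D + D) (≤-trans D≥1 (m≤m+n D D)) ⟩
    (D + D) + (D + D) ≡⟨ solveℕ 1 (λ D → (D :+ℕ D) :+ℕ (D :+ℕ D) :=ℕ D :*ℕ conℕ 4) refl D ⟩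
    D * (2 * 2) ≤⟨ *-monoʳ-≤ D (*-mono-≤ {2} {2 + s} {2} {2 + s} (s≤s (s≤s z≤n)) (s≤s (s≤s z≤n))) ⟩
    D * ((2 + s) * (2 + s)) ≤⟨ m≤n+m _ (t * t) ⟩
    t * t + D * ((2 + s) * (2 + s)) ∎))
    where
    open ≤-Reasoning
    open import Data.Nat.Solver using () renaming (module +-*-Solver to ℕSolver)
    open ℕSolver using () renaming (solve to solveℕ; _:+_ to _:+ℕ_; _:*_ to _:*ℕ_; _:=_ to _:=ℕ_; con to conℕ)

  module Uniqueness {p} (pp : Prime p) (D : ℕ) (D≥1 : 1 ≤ D) (nonsquare : ∀ r → r * r ≢ 1 + D)
    (a b : ℤ) (p-form : a ℤ.* a ℤ.+ + D ℤ.* (b ℤ.* b) ≡ + p) where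

    private instance
      p≢0 : NonZero p
      p≢0 = prime⇒nonZero pp

    -- Up to signs of coordinates these are (1 - √-D)(a + b √-D) and (1 + √-D)(a + b √-D).
    Conclusion : ℤ → ℤ → Set
    Conclusion x y = (∣ x ∣ ≡ ∣ a ℤ.+ + D ℤ.* b ∣ × ∣ y ∣ ≡ ∣ a ℤ.- b ∣)
                   ⊎ (∣ x ∣ ≡ ∣ a ℤ.- + D ℤ.* b ∣ × ∣ y ∣ ≡ ∣ a ℤ.+ b ∣)

    d = + D
    P = + p

    -- Brahmagupta's identity (a x + D b y)² + D (b x - a y)² = (a² + D b²)(x² + D y²) = (1 + D) p².
    -- As p divides b x - a y, it also divides a x + D b y; the quotients satisfy t² + D s² = 1 + D
    -- and are therefore ±1.
    unique⁺ : ∀ x y → x ℤ.* x ℤ.+ d ℤ.* (y ℤ.* y) ≡ (+ 1 ℤ.+ d) ℤ.* P → P ℤᵈ.∣ b ℤ.* x ℤ.- a ℤ.* y → Conclusion x y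
    unique⁺ x y eq (ℤᵈ.divides s bx-ay≡sp) = finish p∣ax+Dby
      where
      square-divisible : (a ℤ.* x ℤ.+ d ℤ.* (b ℤ.* y)) ℤ.* (a ℤ.* x ℤ.+ d ℤ.* (b ℤ.* y)) ≡
          ((+ 1 ℤ.+ d) ℤ.* P ℤ.- d ℤ.* (s ℤ.* s) ℤ.* P) ℤ.* P
      square-divisible = trans
        (solve 5 (λ a b x y d → (a :* x :+ d :* (b :* y)) :* (a :* x :+ d :* (b :* y))
            := (a :* a :+ d :* (b :* b)) :* (x :* x :+ d :* (y :* y)) :- d :*
                ((b :* x :- a :* y) :* (b :* x :- a :* y))) refl a b x y d)
        (trans (cong₂ (λ t w → t ℤ.- d ℤ.* (w ℤ.* w)) (cong₂ ℤ._*_ p-form eq) bx-ay≡sp)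
        (solve 3 (λ d s P → P :* ((con (+ 1) :+ d) :* P) :- d :* (s :* P :* (s :* P)) :=
            ((con (+ 1) :+ d) :* P :- d :* (s :* s) :* P) :* P) refl d s P))
      p∣ax+Dby : P ℤᵈ.∣ a ℤ.* x ℤ.+ d ℤ.* (b ℤ.* y)
      p∣ax+Dby = ℤᵈ.∣ᵤ⇒∣ (prime∣square pp (subst (p ∣_) (ℤ.∣i*j∣≡∣i∣*∣j∣ w w)
          (ℤᵈ.∣⇒∣ᵤ {P} (ℤᵈ.divides ((+ 1 ℤ.+ d) ℤ.* P ℤ.- d ℤ.* (s ℤ.* s) ℤ.* P) square-divisible))))
        where w = a ℤ.* x ℤ.+ d ℤ.* (b ℤ.* y)
      finish : P ℤᵈ.∣ a ℤ.* x ℤ.+ d ℤ.* (b ℤ.* y) → Conclusion x y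
      finish (ℤᵈ.divides t ax+Dby≡tp) = signs (∣i∣≡1 t (proj₁ ts)) (∣i∣≡1 s (proj₂ ts))
        where
        norm : t ℤ.* t ℤ.+ d ℤ.* (s ℤ.* s) ≡ + 1 ℤ.+ d
        norm = ℤ.*-cancelʳ-≡ _ _ P (ℤ.*-cancelʳ-≡ _ _ P (trans
          (solve 4 (λ t s d P → (t :* t :+ d :* (s :* s)) :* P :* P := t :* P :* (t :* P) :+ d :*
              (s :* s) :* P :* P) refl t s d P)
          (trans (cong (λ w → w ℤ.* w ℤ.+ d ℤ.* (s ℤ.* s) ℤ.* P ℤ.* P) (sym ax+Dby≡tp))
          (trans (cong (ℤ._+ d ℤ.* (s ℤ.* s) ℤ.* P ℤ.* P) square-divisible)
          (solve 3 (λ s d P → ((con (+ 1) :+ d) :* P :- d :* (s :* s) :* P) :* P :+ d :* (s :* s) :* P :* P :=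
              (con (+ 1) :+ d) :* P :* P) refl s d P)))))
        ts : ∣ t ∣ ≡ 1 × ∣ s ∣ ≡ 1
        ts = small-form D ∣ t ∣ ∣ s ∣ D≥1 nonsquare (ℤ.+-injective (trans (form-pos D t s) norm))
        -- The system a x + D b y = t p, b x - a y = s p has determinant -(a² + D b²) = -p, so
        -- solving it for x and y cancels p exactly.
        x≡ : x ≡ a ℤ.* t ℤ.+ d ℤ.* (b ℤ.* s)
        x≡ = ℤ.*-cancelʳ-≡ _ _ P (trans (cong (x ℤ.*_) (sym p-form)) (trans
          (solve 5 (λ a b x y d → x :* (a :* a :+ d :* (b :* b)) := a :* (a :* x :+ d :* (b :* y)) :+ d :*
              (b :* (b :* x :- a :* y))) refl a b x y d)
          (trans (cong₂ (λ u w → a ℤ.* u ℤ.+ d ℤ.* (b ℤ.* w)) ax+Dby≡tp bx-ay≡sp)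
          (solve 6 (λ a b t s d P → a :* (t :* P) :+ d :* (b :* (s :* P)) :=
              (a :* t :+ d :* (b :* s)) :* P) refl a b t s d P))))
        y≡ : y ≡ b ℤ.* t ℤ.- a ℤ.* s
        y≡ = ℤ.*-cancelʳ-≡ _ _ P (trans (cong (y ℤ.*_) (sym p-form)) (trans
          (solve 5 (λ a b x y d → y :* (a :* a :+ d :* (b :* b)) := b :* (a :* x :+ d :* (b :* y)) :- a :*
              (b :* x :- a :* y)) refl a b x y d)
          (trans (cong₂ (λ u w → b ℤ.* u ℤ.- a ℤ.* w) ax+Dby≡tp bx-ay≡sp)
          (solve 5 (λ a b t s P → b :* (t :* P) :- a :* (s :* P) := (b :* t :- a :* s) :* P) refl a b t s P))))
        abs-neg : ∀ {i j} → i ≡ ℤ.- j → ∣ i ∣ ≡ ∣ j ∣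
        abs-neg {i} {j} e = trans (cong ∣_∣ e) (ℤ.∣-i∣≡∣i∣ j)
        signs : t ≡ + 1 ⊎ t ≡ -[1+ 0 ] → s ≡ + 1 ⊎ s ≡ -[1+ 0 ] → Conclusion x y
        signs (inj₁ refl) (inj₁ refl) = inj₁
          ( cong ∣_∣ (trans x≡ (solve 3 (λ a b d → a :* con (+ 1) :+ d :*
              (b :* con (+ 1)) := a :+ d :* b) refl a b d))
          , abs-neg (trans y≡ (solve 2 (λ a b → b :* con (+ 1) :- a :* con (+ 1) := :- (a :- b)) refl a b)))
        signs (inj₁ refl) (inj₂ refl) = inj₂
          ( cong ∣_∣ (trans x≡ (solve 3 (λ a b d → a :* con (+ 1) :+ d :*
              (b :* con -[1+ 0 ]) := a :- d :* b) refl a b d))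
          , cong ∣_∣ (trans y≡ (solve 2 (λ a b → b :* con (+ 1) :- a :* con -[1+ 0 ] := a :+ b) refl a b)))
        signs (inj₂ refl) (inj₁ refl) = inj₂
          ( abs-neg (trans x≡ (solve 3 (λ a b d → a :* con -[1+ 0 ] :+ d :* (b :* con (+ 1)) := :-
              (a :- d :* b)) refl a b d))
          , abs-neg (trans y≡ (solve 2 (λ a b → b :* con -[1+ 0 ] :- a :* con (+ 1) := :- (a :+ b)) refl a b)))
        signs (inj₂ refl) (inj₂ refl) = inj₁
          ( abs-neg (trans x≡ (solve 3 (λ a b d → a :* con -[1+ 0 ] :+ d :* (b :* con -[1+ 0 ]) := :-
              (a :+ d :* b)) refl a b d))
          , cong ∣_∣ (trans y≡ (solve 2 (λ a b → b :* con -[1+ 0 ] :- a :* con -[1+ 0 ] := a :- b) refl a b)))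

    -- Modulo p both forms vanish, so p divides (b x - a y)(b x + a y) = b²(x² + D y²) - y²(a² + D
    -- b²) and hence one factor. The second case becomes the first on replacing y by -y.
    unique : ∀ x y → x ℤ.* x ℤ.+ d ℤ.* (y ℤ.* y) ≡ (+ 1 ℤ.+ d) ℤ.* P → Conclusion x y
    unique x y eq with euclidsLemma ∣ b ℤ.* x ℤ.- a ℤ.* y ∣ ∣ b ℤ.* x ℤ.+ a ℤ.* y ∣ pp
        (subst (p ∣_) (ℤ.∣i*j∣≡∣i∣*∣j∣ (b ℤ.* x ℤ.- a ℤ.* y) (b ℤ.* x ℤ.+ a ℤ.* y))
            (ℤᵈ.∣⇒∣ᵤ {P} (ℤᵈ.divides (b ℤ.* b ℤ.* (+ 1 ℤ.+ d) ℤ.- y ℤ.* y) product)))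
      where
      product : (b ℤ.* x ℤ.- a ℤ.* y) ℤ.* (b ℤ.* x ℤ.+ a ℤ.* y) ≡ (b ℤ.* b ℤ.* (+ 1 ℤ.+ d) ℤ.- y ℤ.* y) ℤ.* P
      product = trans
        (solve 5 (λ a b x y d → (b :* x :- a :* y) :* (b :* x :+ a :* y) := b :* b :*
            (x :* x :+ d :* (y :* y)) :- y :* y :* (a :* a :+ d :* (b :* b))) refl a b x y d)
        (trans (cong₂ (λ u w → b ℤ.* b ℤ.* u ℤ.- y ℤ.* y ℤ.* w) eq p-form)
        (solve 4 (λ b y d P → b :* b :* ((con (+ 1) :+ d) :* P) :- y :* y :* P :=
            (b :* b :* (con (+ 1) :+ d) :- y :* y) :* P) refl b y d P))
    ... | inj₁ h = unique⁺ x y eq (ℤᵈ.∣ᵤ⇒∣ h)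
    ... | inj₂ h = subst (λ n → (∣ x ∣ ≡ ∣ a ℤ.+ d ℤ.* b ∣ × n ≡ ∣ a ℤ.- b ∣) ⊎
        (∣ x ∣ ≡ ∣ a ℤ.- d ℤ.* b ∣ × n ≡ ∣ a ℤ.+ b ∣)) (ℤ.∣-i∣≡∣i∣ y)
        (unique⁺ x (ℤ.- y) (trans (cong (λ u → x ℤ.* x ℤ.+ d ℤ.* u)
            (solve 1 (λ y → :- y :* :- y := y :* y) refl y)) eq)
          (subst (P ℤᵈ.∣_) (solve 4 (λ a b x y → b :* x :+ a :* y := b :* x :- a :* :- y) refl a b x y) (ℤᵈ.∣ᵤ⇒∣ h)))

-- Thue's lemma and a small multiple of p of the form a² + D b².

module SmallMultiples where

  open import Data.Fin as Fin using (Fin; toℕ; fromℕ<; remQuot; combine)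
  import Data.Fin.Properties as Fin
  open import Data.Integer as ℤ using (ℤ; +_; ∣_∣)
  import Data.Integer.Properties as ℤ
  import Data.Integer.Divisibility.Signed as ℤᵈ
  open import Data.Integer.Solver using (module +-*-Solver)
  open import Data.Nat
  open import Data.Nat.Divisibility
  open import Data.Nat.DivMod using (m≡m%n+[m/n]*n; m%n<n)
  open import Data.Nat.Primality using (Prime; prime⇒nonZero; prime⇒irreducible; ¬prime[1])
  open import Data.Nat.Properties
  open import Data.Product using (_×_; Σ-syntax; _,_; proj₁; proj₂)
  open import Data.Sum using (inj₁; inj₂)
  open import Relation.Binary.PropositionalEquality
  open import Relation.Nullary using (¬_; yes; no; contradiction)
  open +-*-Solver using (solve; _:=_; _:+_; _:*_; _:-_; :-_)
  open Representations using (prime∣square)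
  open UniqueRepresentation

  sqrt : ∀ n → Σ[ s ∈ ℕ ] s * s ≤ n × n < suc s * suc s
  sqrt zero = 0 , z≤n , s≤s z≤n
  sqrt (suc n) with s , ss≤n , n<ss ← sqrt n with suc s * suc s ≤? suc n
  ... | yes le = suc s , le , ≤-<-trans n<ss (*-mono-< {suc s} {2 + s} ≤-refl ≤-refl)
  ... | no ≰ = s , m≤n⇒m≤1+n ss≤n , ≰⇒> ≰

  prime-nonsquare : ∀ {p} → Prime p → ∀ r → r * r ≢ p
  prime-nonsquare {p} pp r eq with prime⇒irreducible pp (subst (r ∣_) eq (m∣m*n r))
  ... | inj₁ refl = ¬prime[1] (subst Prime (sym eq) pp)
  ... | inj₂ refl = ¬prime[1] (subst Prime (m*n≡n⇒m≡1 r r ⦃ prime⇒nonZero pp ⦄ eq) pp)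
    where
    m*n≡n⇒m≡1 : ∀ m n .⦃ _ : NonZero n ⦄ → m * n ≡ n → m ≡ 1
    m*n≡n⇒m≡1 m n e = *-cancelʳ-≡ m 1 n (trans e (sym (*-identityˡ n)))

  %≡⇒∣- : ∀ m n p .⦃ _ : NonZero p ⦄ → m % p ≡ n % p → + p ℤᵈ.∣ + m ℤ.- + n
  %≡⇒∣- m n p eq = ℤᵈ.divides (+ (m / p) ℤ.- + (n / p))
      (trans (cong₂ ℤ._-_ (decompose m) (trans (decompose n) (cong (λ r → + r ℤ.+ + (n / p) ℤ.* + p) (sym eq))))
    (solve 4 (λ r u w p → (r :+ u :* p) :- (r :+ w :* p) := (u :- w) :* p) refl (+ (m % p)) (+ (m / p))
        (+ (n / p)) (+ p)))
    where
    decompose : ∀ m → + m ≡ + (m % p) ℤ.+ + (m / p) ℤ.* + p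
    decompose m = trans (cong +_ (m≡m%n+[m/n]*n m p))
        (trans (ℤ.pos-+ (m % p) _) (cong (λ w → + (m % p) ℤ.+ w) (ℤ.pos-* (m / p) p)))

  ∣toℕ-toℕ∣≤ : ∀ {s} (f g : Fin (suc s)) → ∣ + toℕ f ℤ.- + toℕ g ∣ ≤ s
  ∣toℕ-toℕ∣≤ f g = ≤-trans (≤-reflexive (cong ∣_∣ (ℤ.m-n≡m⊖n (toℕ f) (toℕ g))))
    (≤-trans (ℤ.∣m⊝n∣≤m⊔n (toℕ f) (toℕ g)) (⊔-lub (s≤s⁻¹ (Fin.toℕ<n f)) (s≤s⁻¹ (Fin.toℕ<n g))))

  -- Thue's lemma. With s the integer square root of p there are (s + 1)² > p pairs with entries
  -- from 0 to s, so two of them give the same residue of x + z y; their difference is the vector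
  -- sought.
  thue : ∀ p .⦃ _ : NonZero p ⦄ z → Σ[ s ∈ ℕ ] s * s ≤ p × (Σ[ x ∈ ℤ ] Σ[ y ∈ ℤ ]
    ∣ x ∣ ≤ s × ∣ y ∣ ≤ s × ¬ (x ≡ + 0 × y ≡ + 0) × + p ℤᵈ.∣ x ℤ.+ + z ℤ.* y)
  thue p z with s , ss≤p , p<ss ← sqrt p = s , ss≤p , from-collision (Fin.pigeonhole p<ss residue)
    where
    coordinates : Fin (suc s * suc s) → Fin (suc s) × Fin (suc s)
    coordinates = remQuot (suc s)
    value : Fin (suc s * suc s) → ℕ
    value i = toℕ (proj₁ (coordinates i)) + z * toℕ (proj₂ (coordinates i))
    residue : Fin (suc s * suc s) → Fin p
    residue i = fromℕ< (m%n<n (value i) p)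
    from-collision : (Σ[ i ∈ Fin (suc s * suc s) ] Σ[ j ∈ Fin (suc s * suc s) ] i Fin.< j × residue i ≡ residue j) →
      Σ[ x ∈ ℤ ] Σ[ y ∈ ℤ ] ∣ x ∣ ≤ s × ∣ y ∣ ≤ s × ¬ (x ≡ + 0 × y ≡ + 0) × + p ℤᵈ.∣ x ℤ.+ + z ℤ.* y
    from-collision (i , j , i<j , eq) = + i₁ ℤ.- + j₁ , + i₂ ℤ.- + j₂
      , ∣toℕ-toℕ∣≤ (proj₁ (coordinates i)) (proj₁ (coordinates j)) , ∣toℕ-toℕ∣≤ (proj₂ (coordinates i))
          (proj₂ (coordinates j))
      , distinct
      , subst (+ p ℤᵈ.∣_) regroup (%≡⇒∣- (value i) (value j) p residues≡)
      where
      i₁ = toℕ (proj₁ (coordinates i))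
      i₂ = toℕ (proj₂ (coordinates i))
      j₁ = toℕ (proj₁ (coordinates j))
      j₂ = toℕ (proj₂ (coordinates j))
      residues≡ : value i % p ≡ value j % p
      residues≡ = trans (sym (Fin.toℕ-fromℕ< (m%n<n (value i) p)))
          (trans (cong toℕ eq) (Fin.toℕ-fromℕ< (m%n<n (value j) p)))
      expand : ∀ m n → + (m + z * n) ≡ + m ℤ.+ + z ℤ.* + n
      expand m n = trans (ℤ.pos-+ m (z * n)) (cong (λ w → + m ℤ.+ w) (ℤ.pos-* z n))
      regroup : + value i ℤ.- + value j ≡ (+ i₁ ℤ.- + j₁) ℤ.+ + z ℤ.* (+ i₂ ℤ.- + j₂)
      regroup = trans (cong₂ ℤ._-_ (expand i₁ i₂) (expand j₁ j₂))
        (solve 5 (λ a b c d z → (a :+ z :* b) :- (c :+ z :* d) := (a :- c) :+ z :* (b :- d)) refl (+ i₁)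
            (+ i₂) (+ j₁) (+ j₂) (+ z))
      coordinate≡ : ∀ (f g : Fin (suc s)) → + toℕ f ℤ.- + toℕ g ≡ + 0 → f ≡ g
      coordinate≡ f g e = Fin.toℕ-injective (ℤ.+-injective (ℤ.i-j≡0⇒i≡j _ _ e))
      distinct : ¬ (+ i₁ ℤ.- + j₁ ≡ + 0 × + i₂ ℤ.- + j₂ ≡ + 0)
      distinct (e₁ , e₂) = Fin.<⇒≢ i<j (trans (sym (Fin.combine-remQuot {suc s} (suc s) i))
        (trans (cong₂ combine (coordinate≡ (proj₁ (coordinates i)) (proj₁ (coordinates j)) e₁)
            (coordinate≡ (proj₂ (coordinates i)) (proj₂ (coordinates j)) e₂))
                (Fin.combine-remQuot {suc s} (suc s) j)))

  -- For x ≡ -z y from Thue's lemma, x² + D y² = (x + z y)(x - z y) + (z² + D) y² is divisible by p.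
  -- It is at most (1 + D) s², and s² < p since a prime is not a square, so the quotient is at most
  -- D.
  small-multiple : ∀ {p} → Prime p → ∀ D z → 1 ≤ D → p ∣ z * z + D →
    Σ[ a ∈ ℕ ] Σ[ b ∈ ℕ ] Σ[ k ∈ ℕ ] (1 ≤ k × k ≤ D × a * a + D * (b * b) ≡ k * p)
  small-multiple {p} pp D z D≥1 p∣z²+D = from-residues (thue p z)
    where
    instance
      p≢0 : NonZero p
      p≢0 = prime⇒nonZero pp
    from-residues : (Σ[ s ∈ ℕ ] s * s ≤ p × (Σ[ x ∈ ℤ ] Σ[ y ∈ ℤ ]
        ∣ x ∣ ≤ s × ∣ y ∣ ≤ s × ¬ (x ≡ + 0 × y ≡ + 0) × + p ℤᵈ.∣ x ℤ.+ + z ℤ.* y)) →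
      Σ[ a ∈ ℕ ] Σ[ b ∈ ℕ ] Σ[ k ∈ ℕ ] (1 ≤ k × k ≤ D × a * a + D * (b * b) ≡ k * p)
    from-residues (s , s²≤p , x , y , x≤s , y≤s , nonzero , ℤᵈ.divides t x+zy≡tp) = conclude p∣form
      where
      a = ∣ x ∣
      b = ∣ y ∣
      form<  : a * a + D * (b * b) < suc D * p
      form< = ≤-<-trans (+-mono-≤ (*-mono-≤ x≤s x≤s) (*-monoʳ-≤ D (*-mono-≤ y≤s y≤s)))
        (*-monoʳ-< (suc D) (≤∧≢⇒< s²≤p (prime-nonsquare pp s)))
      positive : ∀ {k} → a * a + D * (b * b) ≡ k * p → 1 ≤ k
      positive {suc k} _ = s≤s z≤n
      positive {zero} e = contradiction (ℤ.∣i∣≡0⇒i≡0 a≡0 , ℤ.∣i∣≡0⇒i≡0 b≡0) nonzero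
        where
        square≡0 : ∀ n → n * n ≡ 0 → n ≡ 0
        square≡0 zero _ = refl
        a≡0 : a ≡ 0
        a≡0 = square≡0 a (m+n≡0⇒m≡0 (a * a) e)
        b≡0 : b ≡ 0
        b≡0 with m*n≡0⇒m≡0∨n≡0 D (m+n≡0⇒n≡0 (a * a) e)
        ... | inj₁ refl = contradiction D≥1 λ ()
        ... | inj₂ bb≡0 = square≡0 b bb≡0
      conclude : p ∣ a * a + D * (b * b) → _
      conclude (divides k e) = a , b , k , positive e , s≤s⁻¹
          (*-cancelʳ-< _ k (suc D) (subst (_< suc D * p) e form<)) , e
      factor : x ℤ.* x ℤ.+ + D ℤ.* (y ℤ.* y) ≡ t ℤ.* + p ℤ.* (x ℤ.- + z ℤ.* y) ℤ.+ (+ z ℤ.* + z ℤ.+ + D) ℤ.* (y ℤ.* y)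
      factor = trans (solve 4 (λ x y z d → x :* x :+ d :* (y :* y) := (x :+ z :* y) :* (x :- z :* y) :+
          (z :* z :+ d) :* (y :* y)) refl x y (+ z) (+ D))
        (cong (λ w → w ℤ.* (x ℤ.- + z ℤ.* y) ℤ.+ (+ z ℤ.* + z ℤ.+ + D) ℤ.* (y ℤ.* y)) x+zy≡tp)
      r = quotient p∣z²+D
      p∣form : p ∣ a * a + D * (b * b)
      p∣form = ℤᵈ.∣⇒∣ᵤ {+ p} (ℤᵈ.divides (t ℤ.* (x ℤ.- + z ℤ.* y) ℤ.+ + r ℤ.* (y ℤ.* y))
        (trans (form-pos D x y) (trans factor (trans (cong (λ w → t ℤ.* + p ℤ.* (x ℤ.- + z ℤ.* y) ℤ.+ w ℤ.* (y ℤ.* y))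
          (trans (cong (ℤ._+ + D) (sym (ℤ.pos-* z z)))
              (trans (sym (ℤ.pos-+ (z * z) D)) (trans (cong +_ (_∣_.equality p∣z²+D)) (ℤ.pos-* r p)))))
        (solve 5 (λ t p v r w → t :* p :* v :+ r :* p :* w := (t :* v :+ r :* w) :* p) refl t (+ p)
            (x ℤ.- + z ℤ.* y) (+ r) (y ℤ.* y))))))

-- From a small multiple of p to a representation of p itself.

module PrimeRepresentation where

  open import Defs
  open import Data.Fin as Fin using (Fin; toℕ; fromℕ<)
  open import Data.Fin.Patterns
  import Data.Fin.Properties as Fin
  import Data.Integer.Solver
  import Data.Nat.Solver
  open import Data.Nat
  open import Data.Nat.Divisibility
  open import Data.Nat.DivMod using (m≡m%n+[m/n]*n; m%n<n; [m+kn]%n≡m%n)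
  open import Data.Nat.Primality using (Prime; prime?; prime⇒nonZero; prime⇒irreducible)
  open import Data.Nat.Properties
  open import Data.Product using (_×_; Σ-syntax; _,_; proj₁; proj₂)
  open import Data.Sum using (inj₂)
  open import Relation.Binary.PropositionalEquality
  open import Relation.Nullary using (contradiction; ¬?; _→-dec_; _×-dec_)
  open import Relation.Nullary.Decidable using (from-yes)
  open Data.Nat.Solver.+-*-Solver using (solve; con; _:=_; _:+_; _:*_)
  open SeriesMod3
  open Pentagonal
  open PartitionSeries
  open Representations
  open UniqueRepresentation
  open SmallMultiples

  form : ℕ → ℕ → ℕ → ℕ
  form D a b = a * a + D * (b * b)

  form-% : ∀ D m .⦃ _ : NonZero m ⦄ a b → form D a b % m ≡ form D (a % m) (b % m) % m
  form-% D m a b = trans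
    (cong (_% m) (trans (cong₂ (form D) (m≡m%n+[m/n]*n a m) (m≡m%n+[m/n]*n b m))
      (solve 6 (λ a s b t D m → (a :+ s :* m) :* (a :+ s :* m) :+ D :* ((b :+ t :* m) :* (b :+ t :* m))
        := a :* a :+ D :* (b :* b) :+ (con 2 :* a :* s :+ s :* s :* m :+ D :* (con 2 :* b :* t :+ t :* t :* m)) :* m)
        refl (a % m) (a / m) (b % m) (b / m) D m)))
    ([m+kn]%n≡m%n (form D (a % m) (b % m)) (2 * (a % m) * (a / m) + a / m * (a / m) * m + D *
        (2 * (b % m) * (b / m) + b / m * (b / m) * m)) m)

  -- Any property of the residues of a, b and the form is thereby decided on the m² pairs of
  -- residues.
  form-residues : ∀ D m .⦃ _ : NonZero m ⦄ (Q : ℕ → ℕ → ℕ → Set) →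
    (∀ (i j : Fin m) → Q (toℕ i) (toℕ j) (form D (toℕ i) (toℕ j) % m)) → ∀ a b → Q (a % m) (b % m) (form D a b % m)
  form-residues D m Q check a b = subst (Q (a % m) (b % m)) (sym (form-% D m a b))
    (subst₂ (λ i j → Q i j (form D i j % m)) (Fin.toℕ-fromℕ< (m%n<n a m)) (Fin.toℕ-fromℕ< (m%n<n b m))
      (check (fromℕ< (m%n<n a m)) (fromℕ< (m%n<n b m))))

  1+q*m : ∀ p m .⦃ _ : NonZero m ⦄ → p % m ≡ 1 → p ≡ 1 + p / m * m
  1+q*m p m e = trans (m≡m%n+[m/n]*n p m) (cong (_+ p / m * m) e)

  -- The difference k p - k = q k l is a multiple of m because k l is. The modulus m can thus be
  -- larger than the one, l, at which p is known.
  multiple-residue : ∀ k m l r p q .⦃ _ : NonZero m ⦄ → p ≡ 1 + q * l → r * m ≡ k * l → (k * p) % m ≡ k % m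
  multiple-residue k m l r _ q refl e = trans (cong (_% m) (trans
      (solve 3 (λ k q l → k :* (con 1 :+ q :* l) := k :+ q :* (k :* l)) refl k q l)
      (trans (cong (λ t → k + q * t) (sym e)) (cong (k +_) (sym (*-assoc q r m))))))
    ([m+kn]%n≡m%n k (q * r) m)

  Represented : ℕ → ℕ → Set
  Represented D p = Σ[ a ∈ ℕ ] Σ[ b ∈ ℕ ] form D a b ≡ p

  -- The prime D divides a = c D, and cancelling D leaves p = b² + D c²: the two variables exchange
  -- roles.
  represented-D : ∀ D a b {p} → Prime D → form D a b ≡ D * p → Represented D p
  represented-D D a b {p} pD eq with prime∣square {x = a} pD
      (∣m+n∣m⇒∣n (subst (D ∣_) (trans (sym eq) (+-comm (a * a) (D * (b * b)))) (m∣m*n p)) (m∣m*n (b * b)))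
  ... | divides c refl = b , c , *-cancelˡ-≡ (form D b c) p D ⦃ prime⇒nonZero pD ⦄ (trans
    (solve 3 (λ b c D → D :* (b :* b :+ D :* (c :* c)) := c :* D :* (c :* D) :+ D :* (b :* b)) refl b c D) eq)

  represented-4 : ∀ D a b {p} → 2 ∣ a → 2 ∣ b → form D a b ≡ 4 * p → Represented D p
  represented-4 D .(a * 2) .(b * 2) {p} (divides-refl a) (divides-refl b) eq = a , b , *-cancelˡ-≡
      (form D a b) p 4 (trans
    (solve 3 (λ a b D → con 4 :* (a :* a :+ D :* (b :* b)) := a :* con 2 :* (a :* con 2) :+ D :*
        (b :* con 2 :* (b :* con 2))) refl a b D) eq)

  even-residues : ∀ D → (∀ (i j : Fin 8) → form D (toℕ i) (toℕ j) % 8 ≡ 4 → 2 ∣ toℕ i × 2 ∣ toℕ j) →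
    ∀ a b → form D a b % 8 ≡ 4 → 2 ∣ a × 2 ∣ b
  even-residues D check a b e = ∣n∣m%n⇒∣m {8} {m = a} (divides 4 refl)
      (proj₁ residues) , ∣n∣m%n⇒∣m {8} {m = b} (divides 4 refl) (proj₂ residues)
    where
    residues : 2 ∣ a % 8 × 2 ∣ b % 8
    residues = form-residues D 8 (λ i j r → r ≡ 4 → 2 ∣ i × 2 ∣ j) check a b e

  excluded : ∀ D m .⦃ _ : NonZero m ⦄ r → (∀ (i j : Fin m) → form D (toℕ i) (toℕ j) % m ≢ r) → ∀ a b n →
      form D a b ≡ n → n % m ≢ r
  excluded D m r check a b _ refl = form-residues D m (λ _ _ s → s ≢ r) check a b

  represented-1 : ∀ D a b {p} → form D a b ≡ 1 * p → Represented D p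
  represented-1 D a b {p} eq = a , b , trans eq (*-identityˡ p)

  prime-2 : Prime 2
  prime-2 = from-yes (prime? 2)

  represented₂ : ∀ {p} a b k → 1 ≤ k → k ≤ 2 → form 2 a b ≡ k * p → Represented 2 p
  represented₂ a b 1 _ _ = represented-1 2 a b
  represented₂ a b 2 _ _ = represented-D 2 a b prime-2
  represented₂ a b (suc (suc (suc k))) _ (s≤s (s≤s ()))

  form-5-mod-8-≢2 : ∀ (i j : Fin 8) → form 5 (toℕ i) (toℕ j) % 8 ≢ 2
  form-5-mod-8-≢2 = from-yes (Fin.all? λ (i : Fin 8) → Fin.all? λ (j : Fin 8) → ¬? (form 5 (toℕ i) (toℕ j) % 8 ≟ 2))

  form-5-mod-4-≢3 : ∀ (i j : Fin 4) → form 5 (toℕ i) (toℕ j) % 4 ≢ 3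
  form-5-mod-4-≢3 = from-yes (Fin.all? λ (i : Fin 4) → Fin.all? λ (j : Fin 4) → ¬? (form 5 (toℕ i) (toℕ j) % 4 ≟ 3))

  form-7-mod-4-≢2 : ∀ (i j : Fin 4) → form 7 (toℕ i) (toℕ j) % 4 ≢ 2
  form-7-mod-4-≢2 = from-yes (Fin.all? λ (i : Fin 4) → Fin.all? λ (j : Fin 4) → ¬? (form 7 (toℕ i) (toℕ j) % 4 ≟ 2))

  form-7-mod-9-≢3 : ∀ (i j : Fin 9) → form 7 (toℕ i) (toℕ j) % 9 ≢ 3
  form-7-mod-9-≢3 = from-yes (Fin.all? λ (i : Fin 9) → Fin.all? λ (j : Fin 9) → ¬? (form 7 (toℕ i) (toℕ j) % 9 ≟ 3))

  form-7-mod-9-≢6 : ∀ (i j : Fin 9) → form 7 (toℕ i) (toℕ j) % 9 ≢ 6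
  form-7-mod-9-≢6 = from-yes (Fin.all? λ (i : Fin 9) → Fin.all? λ (j : Fin 9) → ¬? (form 7 (toℕ i) (toℕ j) % 9 ≟ 6))

  form-5-mod-8-≡4 : ∀ (i j : Fin 8) → form 5 (toℕ i) (toℕ j) % 8 ≡ 4 → 2 ∣ toℕ i × 2 ∣ toℕ j
  form-5-mod-8-≡4 = from-yes (Fin.all? λ (i : Fin 8) → Fin.all? λ (j : Fin 8) →
      (form 5 (toℕ i) (toℕ j) % 8 ≟ 4) →-dec (2 ∣? toℕ i ×-dec 2 ∣? toℕ j))

  form-7-mod-8-≡4 : ∀ (i j : Fin 8) → form 7 (toℕ i) (toℕ j) % 8 ≡ 4 → 2 ∣ toℕ i × 2 ∣ toℕ j
  form-7-mod-8-≡4 = from-yes (Fin.all? λ (i : Fin 8) → Fin.all? λ (j : Fin 8) →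
      (form 7 (toℕ i) (toℕ j) % 8 ≟ 4) →-dec (2 ∣? toℕ i ×-dec 2 ∣? toℕ j))

  form-7-mod-5-≡0 : ∀ (i j : Fin 5) → form 7 (toℕ i) (toℕ j) % 5 ≡ 0 → 5 ∣ toℕ i × 5 ∣ toℕ j
  form-7-mod-5-≡0 = from-yes (Fin.all? λ (i : Fin 5) → Fin.all? λ (j : Fin 5) →
      (form 7 (toℕ i) (toℕ j) % 5 ≟ 0) →-dec (5 ∣? toℕ i ×-dec 5 ∣? toℕ j))

  -- The other class of discriminant -20, that of 2x² + 2xy + 3y², would show up as k = 2 or k = 3;
  -- p ≡ 1 (mod 4) excludes these modulo 8 and modulo 4. For k = 4 both a and b are even and can be
  -- halved, and k = 5 cancels D.
  represented₅ : ∀ {p} → p % 4 ≡ 1 → ∀ a b k → 1 ≤ k → k ≤ 5 → form 5 a b ≡ k * p → Represented 5 p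
  represented₅ p%4 a b 1 _ _ eq = represented-1 5 a b eq
  represented₅ {p} p%4 a b 2 _ _ eq = contradiction (multiple-residue 2 8 4 1 p (p / 4) (1+q*m p 4 p%4) refl)
    (excluded 5 8 2 form-5-mod-8-≢2 a b (2 * p) eq)
  represented₅ {p} p%4 a b 3 _ _ eq = contradiction (multiple-residue 3 4 4 3 p (p / 4) (1+q*m p 4 p%4) refl)
    (excluded 5 4 3 form-5-mod-4-≢3 a b (3 * p) eq)
  represented₅ {p} p%4 a b 4 _ _ eq
    = represented-4 5 a b (proj₁ evens) (proj₂ evens) eq
    where
    evens : 2 ∣ a × 2 ∣ b
    evens = even-residues 5 form-5-mod-8-≡4 a b
      (trans (cong (_% 8) eq) (multiple-residue 4 8 4 2 p (p / 4) (1+q*m p 4 p%4) refl))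
  represented₅ p%4 a b 5 _ _ eq = represented-D 5 a b (from-yes (prime? 5)) eq
  represented₅ _ a b (suc (suc (suc (suc (suc (suc k)))))) _ (s≤s (s≤s (s≤s (s≤s (s≤s ())))))

  -- k = 2 fails modulo 4. Since -7 is a non-square modulo 3 and modulo 5, a form value divisible by
  -- 3 is divisible by 9, which excludes k = 3 and k = 6, and k = 5 would make p divisible by 5. k =
  -- 4 is halved and k = 7 cancels D.
  represented₇ : ∀ {p} → Prime p → p % 6 ≡ 1 → ∀ a b k → 1 ≤ k → k ≤ 7 → form 7 a b ≡ k * p → Represented 7 p
  represented₇ pp p%6 a b 1 _ _ eq = represented-1 7 a b eq
  represented₇ {p} pp p%6 a b 2 _ _ eq = contradiction (multiple-residue 2 4 6 3 p (p / 6) (1+q*m p 6 p%6) refl)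
    (excluded 7 4 2 form-7-mod-4-≢2 a b (2 * p) eq)
  represented₇ {p} pp p%6 a b 3 _ _ eq = contradiction (multiple-residue 3 9 6 2 p (p / 6) (1+q*m p 6 p%6) refl)
    (excluded 7 9 3 form-7-mod-9-≢3 a b (3 * p) eq)
  represented₇ {p} pp p%6 a b 4 _ _ eq
    = represented-4 7 a b (proj₁ evens) (proj₂ evens) eq
    where
    evens : 2 ∣ a × 2 ∣ b
    evens = even-residues 7 form-7-mod-8-≡4 a b
      (trans (cong (_% 8) eq) (multiple-residue 4 8 6 3 p (p / 6) (1+q*m p 6 p%6) refl))
  represented₇ {p} pp p%6 a b 5 _ _ eq = contradiction (5∣p 5∣a 5∣b eq) 5∤p
    where
    residues : 5 ∣ a % 5 × 5 ∣ b % 5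
    residues = form-residues 7 5 (λ i j r → r ≡ 0 → 5 ∣ i × 5 ∣ j)
      form-7-mod-5-≡0 a b
      (n∣m⇒m%n≡0 _ 5 (subst (5 ∣_) (sym eq) (m∣m*n p)))
    5∣a = ∣n∣m%n⇒∣m {5} {m = a} ∣-refl (proj₁ residues)
    5∣b = ∣n∣m%n⇒∣m {5} {m = b} ∣-refl (proj₂ residues)
    5∣p : ∀ {a b} → 5 ∣ a → 5 ∣ b → form 7 a b ≡ 5 * p → 5 ∣ p
    5∣p (divides-refl s) (divides-refl t) e = divides (form 7 s t) (*-cancelˡ-≡ p (form 7 s t * 5) 5 (trans (sym e)
      (solve 2 (λ s t → s :* con 5 :* (s :* con 5) :+ con 7 :* (t :* con 5 :* (t :* con 5)) := con 5 :*
          ((s :* s :+ con 7 :* (t :* t)) :* con 5)) refl s t)))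
    5∤p : 5 ∤ p
    5∤p 5∣p with prime⇒irreducible pp 5∣p
    ... | inj₂ refl = contradiction p%6 λ ()
  represented₇ {p} pp p%6 a b 6 _ _ eq = contradiction (multiple-residue 6 9 6 4 p (p / 6) (1+q*m p 6 p%6) refl)
    (excluded 7 9 6 form-7-mod-9-≢6 a b (6 * p) eq)
  represented₇ pp p%6 a b 7 _ _ eq = represented-D 7 a b (from-yes (prime? 7)) eq
  represented₇ _ _ a b (suc (suc (suc (suc (suc (suc (suc (suc k)))))))) _
      (s≤s (s≤s (s≤s (s≤s (s≤s (s≤s (s≤s ())))))))

-- Comparison of the signs of the two representations, modulo 12.

module Signs where

  open import Defs
  open import Data.Fin as Fin using (Fin; toℕ; fromℕ<)
  open import Data.Fin.Patterns
  import Data.Fin.Properties as Fin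
  open import Data.Integer as ℤ using (ℤ)
  import Data.Integer.Properties as ℤ
  import Data.Integer.Solver
  import Data.Nat.Solver
  open import Data.Nat
  open import Data.Nat.Divisibility
  open import Data.Nat.DivMod using (m≡m%n+[m/n]*n; m%n<n)
  open import Data.Nat.Properties
  open import Data.Product using (_×_; _,_; proj₁; proj₂)
  open import Data.Sum using (_⊎_; inj₁; inj₂)
  open import Function using (_∘_)
  open import Relation.Binary.PropositionalEquality
  open import Relation.Nullary using (Dec; ¬?; _→-dec_; _×-dec_; _⊎-dec_)
  open import Relation.Nullary.Decidable using (from-yes)
  open Data.Nat.Solver.+-*-Solver using (solve; con; _:=_; _:+_; _:*_)
  open PrimeRepresentation
  open SeriesMod3
  open Pentagonal
  open PartitionSeries
  open Representations
  open UniqueRepresentation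
  open SmallMultiples

  χ-periodic : ∀ k x → χ (x + k * 12) ≡ χ x
  χ-periodic zero x = cong χ (+-identityʳ x)
  χ-periodic (suc k) x = trans (cong χ (trans (cong (x +_) (+-comm 12 (k * 12)))
      (trans (sym (+-assoc x (k * 12) 12)) (+-comm (x + k * 12) 12))))
    (trans (⊖-involutive (χ (x + k * 12))) (χ-periodic k x))
    where
    ⊖-involutive : ∀ c → ⊖ (⊖ c) ≡ c
    ⊖-involutive = from-yes (Fin.all? λ c → ⊖ (⊖ c) Fin.≟ c)

  χ-residues : ∀ c a b → χ (a + c * b) ≡ χ (a % 12 + c * (b % 12))
  χ-residues c a b = trans (cong χ (trans (cong₂ (λ s t → s + c * t) (m≡m%n+[m/n]*n a 12) (m≡m%n+[m/n]*n b 12))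
      (solve 5 (λ a s b t c → (a :+ s :* con 12) :+ c :* (b :+ t :* con 12) := a :+ c :* b :+
          (s :+ c :* t) :* con 12) refl (a % 12) (a / 12) (b % 12) (b / 12) c)))
    (χ-periodic (a / 12 + c * (b / 12)) (a % 12 + c * (b % 12)))

  χ-even : ∀ e → χ (11 * e) ≡ χ e
  χ-even e = trans (χ-residues 11 0 e) (trans (subst (λ r → χ (11 * r) ≡ χ (1 * r))
      (Fin.toℕ-fromℕ< (m%n<n e 12)) (check (fromℕ< (m%n<n e 12))))
    (trans (sym (χ-residues 1 0 e)) (cong χ (*-identityˡ e))))
    where
    check : ∀ (i : Fin 12) → χ (11 * toℕ i) ≡ χ (1 * toℕ i)
    check = from-yes (Fin.all? λ (i : Fin 12) → χ (11 * toℕ i) Fin.≟ χ (1 * toℕ i))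

  -- 11 ≡ -1 (mod 12).
  χ-∣-∣ : ∀ a b → χ ℤ.∣ ℤ.+ a ℤ.- ℤ.+ b ∣ ≡ χ (a + 11 * b)
  χ-∣-∣ a b with ≤-total b a
  ... | inj₁ b≤a = trans (cong χ (trans (cong ℤ.∣_∣ (ℤ.m-n≡m⊖n a b)) (trans (cong ℤ.∣_∣ (ℤ.⊖-≥ b≤a)) refl)))
    (trans (sym (χ-periodic b (a ∸ b))) (cong χ (trans
      (solve 2 (λ e b → e :+ b :* con 12 := (e :+ b) :+ con 11 :* b) refl (a ∸ b) b)
          (cong (_+ 11 * b) (m∸n+n≡m b≤a)))))
  ... | inj₂ a≤b = trans (cong χ (trans (cong ℤ.∣_∣ (ℤ.m-n≡m⊖n a b)) (ℤ.∣⊖∣-≤ a≤b)))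
    (trans (sym (χ-even (b ∸ a))) (trans (sym (χ-periodic a (11 * (b ∸ a)))) (cong χ (trans
      (solve 2 (λ e a → con 11 :* e :+ a :* con 12 := a :+ con 11 :* (e :+ a)) refl (b ∸ a) a)
          (cong (λ t → a + 11 * t) (m∸n+n≡m a≤b))))))

  -- The representations (a + D b, |a - b|) and (|a - D b|, a + b) of (1 + D) (a² + D b²) have the same
  -- non-zero sign; subtraction is multiplication by 11 modulo 12.
  SameSign : ℕ → ℕ → ℕ → Set
  SameSign D a b = χ (a + D * b) ⊗ χ (a + 11 * b) ≡ χ (a + 11 * D * b) ⊗ χ (a + 1 * b) × χ (a + D * b) ⊗ χ
      (a + 11 * b) ≢ 0F

  -- By the period 12 of χ only the 144 residue pairs matter, and the condition on the form keeps
  -- those that a prime in the classes 1 and e can have.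
  same-sign : ∀ D e → (∀ (i j : Fin 12) → form D (toℕ i) (toℕ j) % 12 ≡ 1 ⊎ form D (toℕ i) (toℕ j) % 12 ≡ e →
      SameSign D (toℕ i) (toℕ j)) →
    ∀ a b → form D a b % 12 ≡ 1 ⊎ form D a b % 12 ≡ e → SameSign D a b
  same-sign D e check a b cond = trans (cong₂ _⊗_ r₁ r₂) (trans (proj₁ reduced) (sym (cong₂ _⊗_ r₃ r₄)))
                               , proj₂ reduced ∘ trans (sym (cong₂ _⊗_ r₁ r₂))
    where
    r₁ = χ-residues D a b
    r₂ = χ-residues 11 a b
    r₃ = χ-residues (11 * D) a b
    r₄ = χ-residues 1 a b
    reduced : SameSign D (a % 12) (b % 12)
    reduced = form-residues D 12 (λ i j r → r ≡ 1 ⊎ r ≡ e → SameSign D i j) check a b cond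

  sameSign? : ∀ D a b → Dec (SameSign D a b)
  sameSign? D a b = (χ (a + D * b) ⊗ χ (a + 11 * b) Fin.≟ χ (a + 11 * D * b) ⊗ χ (a + 1 * b)) ×-dec ¬?
      (χ (a + D * b) ⊗ χ (a + 11 * b) Fin.≟ 0F)

  signCheck? : ∀ D e → Dec (∀ (i j : Fin 12) → form D (toℕ i) (toℕ j) % 12 ≡ 1 ⊎ form D (toℕ i)
      (toℕ j) % 12 ≡ e → SameSign D (toℕ i) (toℕ j))
  signCheck? D e = Fin.all? λ i → Fin.all? λ j →
    ((form D (toℕ i) (toℕ j) % 12 ≟ 1) ⊎-dec (form D (toℕ i) (toℕ j) % 12 ≟ e)) →-dec sameSign? D (toℕ i) (toℕ j)

  same-sign-2 : ∀ a b → form 2 a b % 12 ≡ 1 ⊎ form 2 a b % 12 ≡ 5 → SameSign 2 a b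
  same-sign-2 = same-sign 2 5 (from-yes (signCheck? 2 5))

  same-sign-5 : ∀ a b → form 5 a b % 12 ≡ 1 ⊎ form 5 a b % 12 ≡ 5 → SameSign 5 a b
  same-sign-5 = same-sign 5 5 (from-yes (signCheck? 5 5))

  same-sign-7 : ∀ a b → form 7 a b % 12 ≡ 1 ⊎ form 7 a b % 12 ≡ 7 → SameSign 7 a b
  same-sign-7 = same-sign 7 7 (from-yes (signCheck? 7 7))

-- The coefficient at (p - 1) / d for p = a² + D b².

module SplitPrimes where

  open import Defs
  open import Data.Fin as Fin using (Fin)
  open import Data.Fin.Patterns
  import Data.Fin.Properties as Fin
  open import Data.Integer as ℤ using (ℤ)
  import Data.Integer.Properties as ℤ
  import Data.Integer.Solver
  import Data.Nat.Solver
  open import Data.Nat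
  open import Data.Nat.Divisibility
  open import Data.Nat.Primality using (Prime; prime⇒irreducible)
  open import Data.Nat.Properties
  open import Data.Product using (_×_; _,_; proj₁; proj₂)
  open import Data.Sum using (_⊎_; inj₁; inj₂; [_,_]′)
  open import Function using (_∘_)
  open import Relation.Binary.PropositionalEquality
  open import Relation.Nullary using (contradiction; ¬?; _→-dec_)
  open import Relation.Nullary.Decidable using (from-yes)
  module ℤS = Data.Integer.Solver.+-*-Solver
  open Data.Nat.Solver.+-*-Solver using (solve; con; _:=_; _:+_; _:*_)
  open PrimeRepresentation
  open Signs
  open SeriesMod3
  open Pentagonal
  open PartitionSeries
  open Representations
  open UniqueRepresentation
  open SmallMultiples

  representation-bound : ∀ D n {x y} → 1 ≤ D → Weights.Representation D n x y →
    x ≤ 24 * n + (1 + D) × y ≤ 24 * n + (1 + D)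
  representation-bound D n {x} {y} D≥1 rep =
      ≤-trans (n≤n*n x) (≤-trans (m≤m+n (x * x) _) (≤-reflexive rep))
    , ≤-trans (n≤n*n y) (≤-trans (m≤n*m (y * y) D ⦃ >-nonZero D≥1 ⦄) (≤-trans (m≤n+m _ (x * x)) (≤-reflexive rep)))
    where
    n≤n*n : ∀ n → n ≤ n * n
    n≤n*n zero = z≤n
    n≤n*n (suc n) = m≤m+n (suc n) (n * suc n)

  -- The hypothesis `level` is n = (p - 1) / d cleared of its denominator by 24 = (1 + D) d.
  module Split {p} (pp : Prime p) (v : ℕ) (2≤D : 2 ≤ suc v) (nonsquare : ∀ r → r * r ≢ 2 + v)
    (p≢D : p ≢ suc v) (a b : ℕ) (p-form : form (suc v) a b ≡ p) (sign : SameSign (suc v) a b)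
    (n : ℕ) (level : 24 * n + (2 + v) ≡ (2 + v) * p) where

    D = suc v

    open Weights D n

    b>0 : 0 < b
    b>0 = n≢0⇒n>0 λ { refl → prime-nonsquare pp a (trans
        (sym (trans (cong (a * a +_) (*-zeroʳ D)) (+-identityʳ (a * a)))) p-form) }

    a>0 : 0 < a
    a>0 = n≢0⇒n>0 λ { refl → D∤p (subst (D ∣_) p-form (m∣m*n (b * b))) }
      where
      D∤p : D ∤ p
      D∤p D∣p with prime⇒irreducible pp D∣p
      ... | inj₁ D≡1 = contradiction (sym D≡1) (<⇒≢ 2≤D)
      ... | inj₂ D≡p = p≢D (sym D≡p)

    A B′ : ℤ
    A = ℤ.+ a
    B′ = ℤ.+ b

    x₁ y₁ x₂ y₂ : ℕ
    x₁ = a + D * b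
    y₁ = ℤ.∣ A ℤ.- B′ ∣
    x₂ = ℤ.∣ A ℤ.- ℤ.+ (D * b) ∣
    y₂ = a + b

    D*B : ℤ.+ (D * b) ≡ ℤ.+ D ℤ.* B′
    D*B = ℤ.pos-* D b

    p-formℤ : A ℤ.* A ℤ.+ ℤ.+ D ℤ.* (B′ ℤ.* B′) ≡ ℤ.+ p
    p-formℤ = trans (sym (form-pos D A B′)) (cong ℤ.+_ p-form)

    levelℤ : (ℤ.+ 1 ℤ.+ ℤ.+ D) ℤ.* ℤ.+ p ≡ ℤ.+ (24 * n + (1 + D))
    levelℤ = trans (sym (ℤ.pos-* (1 + D) p)) (cong ℤ.+_ (sym level))

    representation : ∀ x y → x ℤ.* x ℤ.+ ℤ.+ D ℤ.* (y ℤ.* y) ≡ (ℤ.+ 1 ℤ.+ ℤ.+ D) ℤ.*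
        (A ℤ.* A ℤ.+ ℤ.+ D ℤ.* (B′ ℤ.* B′)) →
      Representation ℤ.∣ x ∣ ℤ.∣ y ∣
    representation x y eq = ℤ.+-injective (trans (form-pos D x y)
        (trans eq (trans (cong ((ℤ.+ 1 ℤ.+ ℤ.+ D) ℤ.*_) p-formℤ) levelℤ)))

    representation₁ : Representation x₁ y₁
    representation₁ = representation (A ℤ.+ ℤ.+ (D * b)) (A ℤ.- B′)
        (trans (cong (λ w → (A ℤ.+ w) ℤ.* (A ℤ.+ w) ℤ.+ ℤ.+ D ℤ.* ((A ℤ.- B′) ℤ.* (A ℤ.- B′))) D*B)
      (ℤS.solve 3 (λ a b d → (a ℤS.:+ d ℤS.:* b) ℤS.:* (a ℤS.:+ d ℤS.:* b) ℤS.:+ d ℤS.:*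
          ((a ℤS.:- b) ℤS.:* (a ℤS.:- b))
        ℤS.:= (ℤS.con (ℤ.+ 1) ℤS.:+ d) ℤS.:* (a ℤS.:* a ℤS.:+ d ℤS.:* (b ℤS.:* b))) refl A B′ (ℤ.+ D)))

    representation₂ : Representation x₂ y₂
    representation₂ = representation (A ℤ.- ℤ.+ (D * b)) (A ℤ.+ B′)
        (trans (cong (λ w → (A ℤ.- w) ℤ.* (A ℤ.- w) ℤ.+ ℤ.+ D ℤ.* ((A ℤ.+ B′) ℤ.* (A ℤ.+ B′))) D*B)
      (ℤS.solve 3 (λ a b d → (a ℤS.:- d ℤS.:* b) ℤS.:* (a ℤS.:- d ℤS.:* b) ℤS.:+ d ℤS.:*
          ((a ℤS.:+ b) ℤS.:* (a ℤS.:+ b))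
        ℤS.:= (ℤS.con (ℤ.+ 1) ℤS.:+ d) ℤS.:* (a ℤS.:* a ℤS.:+ d ℤS.:* (b ℤS.:* b))) refl A B′ (ℤ.+ D)))

    unique : ∀ x y → Representation x y → (x ≡ x₁ × y ≡ y₁) ⊎ (x ≡ x₂ × y ≡ y₂)
    unique x y rep = from-ℤ (Uniqueness.unique pp D (<⇒≤ 2≤D) nonsquare A B′ p-formℤ (ℤ.+ x) (ℤ.+ y)
        (trans (sym (form-pos D (ℤ.+ x) (ℤ.+ y))) (trans (cong ℤ.+_ rep) (sym levelℤ))))
      where
      from-ℤ : (x ≡ ℤ.∣ A ℤ.+ ℤ.+ D ℤ.* B′ ∣ × y ≡ y₁) ⊎ (x ≡ ℤ.∣ A ℤ.- ℤ.+ D ℤ.* B′ ∣ × y ≡ y₂) →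
          (x ≡ x₁ × y ≡ y₁) ⊎ (x ≡ x₂ × y ≡ y₂)
      from-ℤ (inj₁ (ex , ey)) = inj₁ (trans ex (cong (λ w → ℤ.∣ A ℤ.+ w ∣) (sym D*B)) , ey)
      from-ℤ (inj₂ (ex , ey)) = inj₂ (trans ex (cong (λ w → ℤ.∣ A ℤ.- w ∣) (sym D*B)) , ey)

    -- |a - D b| ≤ max(a, D b) < a + D b because a and b are positive. The two solutions thus lie in
    -- different rows of the double sum, one in each.
    x₁≢x₂ : x₁ ≢ x₂
    x₁≢x₂ = >⇒≢ (≤-<-trans (≤-trans (≤-reflexive (cong ℤ.∣_∣ (ℤ.m-n≡m⊖n a (D * b)))) (ℤ.∣m⊝n∣≤m⊔n a (D * b)))
      (⊔-lub (m<m+n a (≤-trans b>0 (m≤m+n b (v * b)))) (m<n+m (D * b) a>0)))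

    χx₁ : χ x₁ ⊗ χ y₁ ≢ 0F
    χx₁ e = proj₂ sign (trans (cong (χ x₁ ⊗_) (sym (χ-∣-∣ a b))) e)

    signs≡ : χ x₁ ⊗ χ y₁ ≡ χ x₂ ⊗ χ y₂
    signs≡ = trans (cong (χ x₁ ⊗_) (χ-∣-∣ a b)) (trans (proj₁ sign) (cong₂ _⊗_
      (trans (cong (λ t → χ (a + t)) (*-assoc 11 D b)) (sym (χ-∣-∣ a (D * b))))
          (cong (λ t → χ (a + t)) (*-identityˡ b))))

    χχ≢0⇒weight : ∀ x y → χ x ⊗ χ y ≢ 0F → Representation x y → weight x y ≡ χ x ⊗ χ y
    χχ≢0⇒weight x y ne = weight-representation x y (λ e → ne (cong (_⊗ χ y) e))
        (λ e → ne (trans (cong (χ x ⊗_) e) (⊗-zeroʳ (χ x))))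

    -- The value of the form bounds both coordinates of any representation, so a truncation at this
    -- order has all of them in its box.
    N = 24 * n + (1 + D)

    M = GeneratingFunction.M N

    N<M : N < M
    N<M = ≤-trans (n≤1+n (suc N)) (s≤s (s≤s (m≤m*n N 6)))

    bound : ∀ x y → Representation x y → x < M × y < M
    bound x y rep = ≤-<-trans (proj₁ bounds) N<M , ≤-<-trans (proj₂ bounds) N<M
      where bounds = representation-bound D n {x} {y} (<⇒≤ 2≤D) rep

    row : ∀ x y → Representation x y → (∀ y′ → Representation x y′ → y′ ≡ y) → Σ₃ M (weight x) ≡ weight x y
    row x y rep only = Σ₃-single M y (proj₂ (bound x y rep)) (λ y′ _ y′≢y → weight-zero x y′ (λ r → y′≢y (only y′ r)))

    -- Exactly two pairs contribute, with the same non-zero sign c, and c + c ≠ 0 because 2 is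
    -- invertible modulo 3.
    nonvanishing : mod₃ (B 3 D n) ≢ 0F
    nonvanishing e = twice (χ x₁ ⊗ χ y₁) χx₁ (trans (sym (trans (GeneratingFunction.B-coefficient N v n n≤N)
        (trans (Σ₃-pair M x₁ x₂ (proj₁ (bound x₁ y₁ representation₁))
            (proj₁ (bound x₂ y₂ representation₂)) x₁≢x₂ other-rows)
        (cong₂ _⊕_ row₁ row₂)))) e)
      where
      n≤N : n ≤ N
      n≤N = ≤-trans (m≤n*m n 24) (m≤m+n (24 * n) (1 + D))
      twice : ∀ c → c ≢ 0F → c ⊕ c ≢ 0F
      twice = from-yes (Fin.all? λ c → ¬? (c Fin.≟ 0F) →-dec ¬? (c ⊕ c Fin.≟ 0F))
      other-rows : ∀ x → x ≢ x₁ → x ≢ x₂ → Σ₃ M (weight x) ≡ 0F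
      other-rows x x≢x₁ x≢x₂ = Σ₃-zero M (λ y _ → weight-zero x y λ rep → [ x≢x₁ ∘ proj₁ , x≢x₂ ∘ proj₁ ]′
          (unique x y rep))
      row₁ : Σ₃ M (weight x₁) ≡ χ x₁ ⊗ χ y₁
      row₁ = trans (row x₁ y₁ representation₁ only) (χχ≢0⇒weight x₁ y₁ χx₁ representation₁)
        where
        only : ∀ y → Representation x₁ y → y ≡ y₁
        only y rep = [ proj₂ , (λ e → contradiction (proj₁ e) x₁≢x₂) ]′ (unique x₁ y rep)
      row₂ : Σ₃ M (weight x₂) ≡ χ x₁ ⊗ χ y₁
      row₂ = trans (row x₂ y₂ representation₂ only)
          (trans (χχ≢0⇒weight x₂ y₂ (χx₁ ∘ trans signs≡) representation₂) (sym signs≡))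
        where
        only : ∀ y → Representation x₂ y → y ≡ y₂
        only y rep = [ (λ e → contradiction (sym (proj₁ e)) x₁≢x₂) , proj₂ ]′ (unique x₂ y rep)

-- The arithmetic progressions and the three congruences.

open import Defs
open import Data.Fin as Fin using (Fin; toℕ; fromℕ<)
open import Data.Fin.Patterns
import Data.Fin.Properties as Fin
import Data.Integer.Solver
import Data.Nat.Solver
open import Data.Nat
open import Data.Nat.Divisibility
open import Data.Nat.DivMod using (m≡m%n+[m/n]*n; m%n<n; [m+kn]%n≡m%n; m*n/n≡m)
open import Data.Nat.Primality using (Prime; prime⇒irreducible; ¬prime[1])
open import Data.Nat.Properties
open import Data.Product using (_×_; Σ-syntax; _,_)
open import Data.Sum using (_⊎_; [_,_]′)
open import Function using (_∘_)
open import Relation.Binary.PropositionalEquality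
open import Relation.Nullary using (¬_; Dec; yes; no; contradiction; ¬?; _→-dec_; _⊎-dec_)
open import Relation.Nullary.Decidable using (from-yes; from-no)
open import Data.Empty using (⊥)
open Data.Nat.Solver.+-*-Solver using (solve; con; _:=_; _:+_; _:*_)
open PrimeRepresentation
open Signs
open SplitPrimes
open SeriesMod3
open Pentagonal
open PartitionSeries
open Representations
open UniqueRepresentation
open SmallMultiples

%-coarsen : ∀ n m k .⦃ _ : NonZero n ⦄ .⦃ _ : NonZero m ⦄ → n ≡ k * m → ∀ p → p % m ≡ p % n % m
%-coarsen n m k n≡km p = trans (cong (_% m) (trans (m≡m%n+[m/n]*n p n)
    (cong (p % n +_) (trans (cong (p / n *_) n≡km) (sym (*-assoc (p / n) k m))))))
  ([m+kn]%n≡m%n (p % n) (p / n * k) m)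

-- Applied with m = 1 + D: a prime p ≡ 1 (mod r) dividing m would be one of its finitely many
-- divisors, and by `check` the only divisor in that class is 1.
≡1%⇒∤ : ∀ m r .⦃ _ : NonZero m ⦄ .⦃ _ : NonZero r ⦄ → (∀ (i : Fin (suc m)) → toℕ i ∣ m → toℕ i % r ≡ 1 → toℕ i ≡ 1) →
  ∀ {p} → Prime p → p % r ≡ 1 → p ∤ m
≡1%⇒∤ m r check {p} pp p%r p∣m = ¬prime[1] (subst Prime
    (trans (sym toℕ≡) (check i (subst (_∣ m) (sym toℕ≡) p∣m) (trans (cong (_% r) toℕ≡) p%r))) pp)
  where
  i = fromℕ< (s≤s (∣⇒≤ p∣m))
  toℕ≡ = Fin.toℕ-fromℕ< (s≤s (∣⇒≤ p∣m))

module Progression (v d : ℕ) .⦃ _ : NonZero d ⦄ (cd≡24 : (2 + v) * d ≡ 24) where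

  -- Here k = (P - 1) / d. Since 24 = (1 + D) d, completing squares at the index P n + k gives (1 +
  -- D) P (d n + 1), so the cofactor of P is the number assumed prime to p.
  level-≡ : ∀ P n k → P ≡ 1 + k * d → 24 * (P * n + k) + (2 + v) ≡ (2 + v) * (P * (d * n + 1))
  level-≡ P n k P≡ = trans (cong (λ t → t * (P * n + k) + (2 + v)) (sym cd≡24))
    (trans (solve 5 (λ c d P n k → c :* d :* (P :* n :+ k) :+ c := c :*
        (P :* (d :* n) :+ (con 1 :+ k :* d))) refl (2 + v) d P n k)
    (trans (cong (λ t → (2 + v) * (P * (d * n) + t)) (sym P≡))
    (solve 4 (λ c d P n → c :* (P :* (d :* n) :+ P) := c :* (P :* (d :* n :+ con 1))) refl (2 + v) d P n)))

  index : ∀ P k → P ≡ 1 + k * d → (P ∸ 1) / d ≡ k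
  index P k P≡ = trans (cong (λ t → (t ∸ 1) / d) P≡) (m*n/n≡m k d)

  ^-residue : ∀ p → p % d ≡ 1 → ∀ e → Σ[ k ∈ ℕ ] p ^ e ≡ 1 + k * d
  ^-residue p p%d zero = 0 , refl
  ^-residue p p%d (suc e) with k , eq ← ^-residue p p%d e = p / d * p ^ e + k , (begin
    p * p ^ e ≡⟨ cong (_* p ^ e) (1+q*m p d p%d) ⟩
    (1 + p / d * d) * p ^ e ≡⟨ solve 3 (λ u d q → (con 1 :+ u :* d) :* q := q :+ u :* q :* d) refl (p / d) d (p ^ e) ⟩
    p ^ e + p / d * p ^ e * d ≡⟨ cong (_+ p / d * p ^ e * d) eq ⟩
    1 + k * d + p / d * p ^ e * d ≡⟨ solve 3 (λ k u d → con 1 :+ k :* d :+ u :* d := con 1 :+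
        (u :+ k) :* d) refl k (p / d * p ^ e) d ⟩
    1 + (p / d * p ^ e + k) * d ∎)
    where open ≡-Reasoning

  propagate : ∀ α n p → Prime p → p % d ≡ 1 → p ∤ 2 + v → p ∤ d * n + 1 → (∀ z → p ∤ z * z + suc v) →
    3 ∣ B 3 (suc v) (p ^ (2 * α + 1) * n + (p ^ (2 * α + 1) ∸ 1) / d)
  propagate α n p pp p%d p∤c p∤m inert with k , eq ← ^-residue p p%d (2 * α + 1) =
    subst (λ t → 3 ∣ B 3 (suc v) (p ^ (2 * α + 1) * n + t)) (sym (index (p ^ (2 * α + 1)) k eq))
      (no-representation⇒3∣B v (p ^ (2 * α + 1) * n + k) λ x y rep →
        Inert.odd-power-not-represented pp (suc v) inert (2 + v) (d * n + 1) p∤c p∤m α x y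
          (trans rep (level-≡ (p ^ (2 * α + 1)) n k eq)))

  base-level : ∀ p → p % d ≡ 1 → 24 * ((p ∸ 1) / d) + (2 + v) ≡ (2 + v) * p
  base-level p p%d = trans (cong (λ t → 24 * t + (2 + v)) (index p (p / d) p≡))
    (trans (cong (λ t → 24 * (t + p / d) + (2 + v)) (sym (*-zeroʳ p)))
    (trans (level-≡ p 0 (p / d) p≡) (cong ((2 + v) *_)
        (trans (cong (λ t → p * (t + 1)) (*-zeroʳ d)) (*-identityʳ p)))))
    where p≡ = 1+q*m p d p%d

nonsquare-from : ∀ c k → k * k < c → c < suc k * suc k → ∀ r → r * r ≢ c
nonsquare-from c k kk<c c<kk r eq with r ≤? k
... | yes r≤k = <⇒≢ (≤-<-trans (*-mono-≤ r≤k r≤k) kk<c) eq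
... | no r≰k = <⇒≢ (<-≤-trans c<kk (*-mono-≤ (≰⇒> r≰k) (≰⇒> r≰k))) (sym eq)

residue-class : ∀ p m k .⦃ _ : NonZero m ⦄ e → 12 ≡ k * m →
    (∀ (i : Fin 12) → toℕ i % m ≡ 1 → 3 ∤ toℕ i → toℕ i ≡ 1 ⊎ toℕ i ≡ e) →
  p % m ≡ 1 → 3 ∤ p → p % 12 ≡ 1 ⊎ p % 12 ≡ e
residue-class p m k e 12≡ check p%m 3∤p = subst (λ r → r ≡ 1 ⊎ r ≡ e) toℕ≡
  (check (fromℕ< (m%n<n p 12)) (trans (cong (_% m) toℕ≡) (trans (sym (%-coarsen 12 m k 12≡ p)) p%m))
    (λ 3∣i → 3∤p (∣n∣m%n⇒∣m {12} {m = p} (divides 4 refl) (subst (3 ∣_) toℕ≡ 3∣i))))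
  where toℕ≡ = Fin.toℕ-fromℕ< (m%n<n p 12)

3∤prime : ∀ {p} → Prime p → p ≢ 3 → 3 ∤ p
3∤prime pp p≢3 3∣p = [ (λ ()) , p≢3 ∘ sym ]′ (prime⇒irreducible pp 3∣p)

class₄ : ∀ p → Prime p → p % 4 ≡ 1 → p % 12 ≡ 1 ⊎ p % 12 ≡ 5
class₄ p pp p%4 = residue-class p 4 3 5 refl (from-yes
    (Fin.all? λ (i : Fin 12) → (toℕ i % 4 ≟ 1) →-dec (¬? (3 ∣? toℕ i) →-dec ((toℕ i ≟ 1) ⊎-dec (toℕ i ≟ 5)))))
  p%4 (3∤prime pp λ { refl → contradiction p%4 λ () })

inert₇ : ∀ p → Prime p → p % 6 ≡ 1 → 3 ∣ B 3 7 ((p ∸ 1) / 3) → ∀ z → p ∤ z * z + 7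
inert₇ p pp p%6 3∣B z p∣ = helper (p ≟ 7)
  where
  helper : Dec (p ≡ 7) → ⊥
  -- For p = 7 the index is (7 - 1) / 3 = 2, and `B 3 7 2` evaluates to 5.
  helper (yes refl) = from-no (3 ∣? B 3 7 2) 3∣B
  helper (no p≢7) = rest (represented (small-multiple pp 7 z (s≤s z≤n) p∣))
    where
    represented : (Σ[ a ∈ ℕ ] Σ[ b ∈ ℕ ] Σ[ k ∈ ℕ ] (1 ≤ k × k ≤ 7 × form 7 a b ≡ k * p)) → Represented 7 p
    represented (a , b , k , 1≤k , k≤7 , eq) = represented₇ pp p%6 a b k 1≤k k≤7 eq
    rest : Represented 7 p → ⊥
    rest (a , b , eq) = Split.nonvanishing pp 6 (s≤s (s≤s z≤n))
        (nonsquare-from 8 2 (from-yes (4 <? 8)) (from-yes (8 <? 9)))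
      p≢7 a b eq (same-sign-7 a b (subst (λ t → t % 12 ≡ 1 ⊎ t % 12 ≡ 7) (sym eq) class))
      ((p ∸ 1) / 3) (Progression.base-level 6 3 refl p p%3) (3∣⇒mod₃≡0 3∣B)
      where
      p%3 : p % 3 ≡ 1
      p%3 = trans (%-coarsen 6 3 2 refl p) (cong (_% 3) p%6)
      class : p % 12 ≡ 1 ⊎ p % 12 ≡ 7
      class = residue-class p 6 2 7 refl (from-yes
          (Fin.all? λ (i : Fin 12) → (toℕ i % 6 ≟ 1) →-dec (¬? (3 ∣? toℕ i) →-dec ((toℕ i ≟ 1) ⊎-dec (toℕ i ≟ 7)))))
        p%6 (3∤prime pp λ { refl → contradiction p%6 λ () })

inert₅ : ∀ p → Prime p → p % 4 ≡ 1 → 3 ∣ B 3 5 ((p ∸ 1) / 4) → ∀ z → p ∤ z * z + 5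
inert₅ p pp p%4 3∣B z p∣ = helper (p ≟ 5)
  where
  helper : Dec (p ≡ 5) → ⊥
  -- For p = 5 the index is (5 - 1) / 4 = 1, and `B 3 5 1` evaluates to 2.
  helper (yes refl) = from-no (3 ∣? B 3 5 1) 3∣B
  helper (no p≢5) = rest (represented (small-multiple pp 5 z (s≤s z≤n) p∣))
    where
    represented : (Σ[ a ∈ ℕ ] Σ[ b ∈ ℕ ] Σ[ k ∈ ℕ ] (1 ≤ k × k ≤ 5 × form 5 a b ≡ k * p)) → Represented 5 p
    represented (a , b , k , 1≤k , k≤5 , eq) = represented₅ p%4 a b k 1≤k k≤5 eq
    rest : Represented 5 p → ⊥
    rest (a , b , eq) = Split.nonvanishing pp 4 (s≤s (s≤s z≤n))
        (nonsquare-from 6 2 (from-yes (4 <? 6)) (from-yes (6 <? 9)))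
      p≢5 a b eq (same-sign-5 a b (subst (λ t → t % 12 ≡ 1 ⊎ t % 12 ≡ 5) (sym eq) (class₄ p pp p%4)))
      ((p ∸ 1) / 4) (Progression.base-level 4 4 refl p p%4) (3∣⇒mod₃≡0 3∣B)

inert₂ : ∀ p → Prime p → p % 8 ≡ 1 → 3 ∣ B 3 2 ((p ∸ 1) / 8) → ∀ z → p ∤ z * z + 2
inert₂ p pp p%8 3∣B z p∣ = rest (represented (small-multiple pp 2 z (s≤s z≤n) p∣))
  where
  represented : (Σ[ a ∈ ℕ ] Σ[ b ∈ ℕ ] Σ[ k ∈ ℕ ] (1 ≤ k × k ≤ 2 × form 2 a b ≡ k * p)) → Represented 2 p
  represented (a , b , k , 1≤k , k≤2 , eq) = represented₂ a b k 1≤k k≤2 eq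
  rest : Represented 2 p → ⊥
  rest (a , b , eq) = Split.nonvanishing pp 1 (s≤s (s≤s z≤n))
      (nonsquare-from 3 1 (from-yes (1 <? 3)) (from-yes (3 <? 4)))
    -- The ramified prime p = 2 is not congruent to 1 modulo 8.
    (λ { refl → contradiction p%8 λ () }) a b eq (same-sign-2 a b
        (subst (λ t → t % 12 ≡ 1 ⊎ t % 12 ≡ 5) (sym eq) (class₄ p pp p%4)))
    ((p ∸ 1) / 8) (Progression.base-level 1 8 refl p p%8) (3∣⇒mod₃≡0 3∣B)
    where
    p%4 : p % 4 ≡ 1
    p%4 = trans (%-coarsen 8 4 2 refl p) (cong (_% 4) p%8)

theorem1p5 : ((α n p : ℕ) → Prime p → p % 6 ≡ 1 → ¬ (p ∣ 3 * n + 1) → 3 ∣ B 3 7 ((p ∸ 1) / 3) →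
    3 ∣ B 3 7 (p ^ (2 * α + 1) * n + (p ^ (2 * α + 1) ∸ 1) / 3))
    × ((α n p : ℕ) → Prime p → p % 4 ≡ 1 → ¬ (p ∣ 4 * n + 1) → 3 ∣ B 3 5 ((p ∸ 1) / 4) →
    3 ∣ B 3 5 (p ^ (2 * α + 1) * n + (p ^ (2 * α + 1) ∸ 1) / 4))
    × ((α n p : ℕ) → Prime p → p % 8 ≡ 1 → ¬ (p ∣ 8 * n + 1) → 3 ∣ B 3 2 ((p ∸ 1) / 8) →
    3 ∣ B 3 2 (p ^ (2 * α + 1) * n + (p ^ (2 * α + 1) ∸ 1) / 8))
theorem1p5 =
    (λ α n p pp p%6 p∤m 3∣B → Progression.propagate 6 3 refl α n p pp
        (trans (%-coarsen 6 3 2 refl p) (cong (_% 3) p%6))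
      (≡1%⇒∤ 8 6 (from-yes (Fin.all? λ (i : Fin 9) → (toℕ i ∣? 8) →-dec
          ((toℕ i % 6 ≟ 1) →-dec (toℕ i ≟ 1)))) pp p%6) p∤m (inert₇ p pp p%6 3∣B))
  , (λ α n p pp p%4 p∤m 3∣B → Progression.propagate 4 4 refl α n p pp p%4
      (≡1%⇒∤ 6 4 (from-yes (Fin.all? λ (i : Fin 7) → (toℕ i ∣? 6) →-dec
          ((toℕ i % 4 ≟ 1) →-dec (toℕ i ≟ 1)))) pp p%4) p∤m (inert₅ p pp p%4 3∣B))
  , (λ α n p pp p%8 p∤m 3∣B → Progression.propagate 1 8 refl α n p pp p%8
      (≡1%⇒∤ 3 8 (from-yes (Fin.all? λ (i : Fin 4) → (toℕ i ∣? 3) →-dec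
          ((toℕ i % 8 ≟ 1) →-dec (toℕ i ≟ 1)))) pp p%8) p∤m (inert₂ p pp p%8 3∣B))
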